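{- For every positive integer $n$, $$M_e(\mathcal{D},n)-M_o(\mathcal{D},n)=\begin{cases} 1, & \text{if } n\in\mathcal{P} \text{ and } R(n) \text{ is odd and positive},\\ -1, & \text{if } n\in\mathcal{P} \text{ and } R(n) \text{ is not odd and positive},\\ 2, & \text{if } n\notin\mathcal{P},\ R(\lfloor n\rfloor_p) \text{ is odd and positive, and } n\equiv\lfloor n\rfloor_p \pmod 2,\\ -2, & \text{if } n\notin\mathcal{P},\ R(\lfloor n\rfloor_p) \text{ is even and positive, and } n\equiv\lfloor n\rfloor_p \pmod 2,\\ -2(-1)^{n-\lfloor n\rfloor_p}, & \text{if } n\notin\mathcal{P} \text{ and } R(\lfloor n\rfloor_p) \text{ is even and negative},\\ 0, & \text{otherwise}. \end{cases}$$
   Context: $M_e(\mathcal{D},n)$ (resp. $M_o(\mathcal{D},n)$) is the number of partitions of $n$ into distinct parts with even (resp. odd) crank, where for a partition into distinct parts the crank is its largest part if $1$ is not a part, and is (number of parts) $-2$ if $1$ is a part. $\mathcal{P}=\{m(3m+1)/2: m\in\mathbb{Z}\}$ is the set of (generalized) pentagonal numbers; for $n=m(3m+1)/2\in\mathcal{P}$ put $R(n)=m$ (well defined since distinct integers $m$ give distinct values). $\lfloor n\rfloor_p$ denotes the largest element of $\mathcal{P}$ that is $\le n$. -}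

module Defs where

open import Data.Bool.Base using (if_then_else_)
open import Data.Empty using (⊥-elim)
open import Data.Integer.Base as ℤ using (ℤ; +_; -_; ∣_∣; 0ℤ)
import Data.Integer.Divisibility as ℤ
import Data.Integer.Properties as ℤ
import Data.Integer.Tactic.RingSolver as ℤ-Solver
open import Data.List.Base using (List; []; _∷_; [_]; _++_; length; map; filter)
open import Data.List.Extrema.Nat using (max)
open import Data.List.Membership.Propositional using () renaming (_∈_ to _∈ˡ_)
open import Data.List.Membership.Propositional.Properties using (∈-++⁺ˡ; ∈-++⁺ʳ; ∈-++⁻; ∈-map⁺; ∈-map⁻; ∈-filter⁺; ∈-filter⁻)
open import Data.List.Properties using (∷-injectiveʳ)
open import Data.List.Relation.Unary.All as All using (All; []; _∷_)
open import Data.List.Relation.Unary.Any using (here)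
open import Data.List.Relation.Unary.Linked as Linked using (Linked; []; [-]; _∷_)
open import Data.List.Relation.Unary.Unique.Propositional using (Unique; []; _∷_)
import Data.List.Relation.Unary.Unique.Propositional.Properties as Unique
open import Data.Nat.Base using (ℕ; zero; suc; _+_; _*_; _≤_; _<_; _>_; z≤n; s≤s)
open import Data.Nat.DivMod using (_%_)
open import Data.Nat.Divisibility using (_∣?_)
open import Data.Nat.ListAction using (sum)
open import Data.Nat.Properties using (_≟_; ≤-refl; ≤-trans; m≤n⇒m≤1+n; m≤n⇒m<n∨m≡n; <-irrefl; m≤m+n; anyUpTo?; *-monoʳ-≤; *-cancelˡ-≤; *-comm; +-cancelʳ-≤; module ≤-Reasoning)
open import Data.List.Membership.DecPropositional _≟_ using (_∈?_)
open import Data.Product.Base using (Σ; ∃; _×_; _,_; proj₁; proj₂)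
open import Data.Sum.Base using (_⊎_; inj₁; inj₂; [_,_]′)
open import Function.Base using (_∘_)
open import Level using (0ℓ)
open import Relation.Binary.PropositionalEquality using (_≡_; refl; sym; trans; cong; subst; module ≡-Reasoning)
open import Relation.Nullary.Decidable using (Dec; yes; no; does; ¬?; _⊎-dec_; map′)
open import Relation.Nullary.Negation using (¬_)
open import Relation.Unary using (Pred; Decidable; _∈_; _∉_)

Even Odd Positive Negative : Pred ℤ 0ℓ
Even     m = + 2 ℤ.∣ m
Odd      m = ¬ Even m
Positive m = 0ℤ ℤ.< m
Negative m = m ℤ.< 0ℤ

even? : Decidable Even
even? m = 2 ∣? ∣ m ∣

odd? : Decidable Odd
odd? m = ¬? (even? m)

-- A partition is represented by the list of its parts in decreasing order.
record _IsDistinctPartitionOf_ (ps : List ℕ) (n : ℕ) : Set where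
  field
    parts-positive   : All (0 <_) ps
    parts-decreasing : Linked _>_ ps
    parts-sum        : sum ps ≡ n

-- On a partition `max 0` is the largest part, since parts are positive
-- (and 0 only for the empty partition).
crank : List ℕ → ℤ
crank ps = if does (1 ∈? ps) then + length ps ℤ.- + 2 else + max 0 ps

-- All strictly decreasing lists of positive integers ≤ k.
distinctPartsUpTo : ℕ → List (List ℕ)
distinctPartsUpTo zero    = [ [] ]
distinctPartsUpTo (suc k) =
  distinctPartsUpTo k ++ map (suc k ∷_) (distinctPartsUpTo k)

-- Lists every partition of n into distinct parts exactly once; see
-- `distinctPartitions-sound`, `-complete` and `-unique` below.
distinctPartitions : ℕ → List (List ℕ)
distinctPartitions n = filter (λ ps → sum ps ≟ n) (distinctPartsUpTo n)

Mₑ Mₒ : ℕ → ℕ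
Mₑ n = length (filter (even? ∘ crank) (distinctPartitions n))
Mₒ n = length (filter (odd?  ∘ crank) (distinctPartitions n))

-- n = m(3m+1)/2, with the denominator cleared.
𝒫 : Pred ℕ 0ℓ
𝒫 n = ∃ λ (m : ℤ) → + 2 ℤ.* + n ≡ m ℤ.* (+ 3 ℤ.* m ℤ.+ + 1)

-- Independent of the membership proof by `R-unique` below.
R : ∀ n → n ∈ 𝒫 → ℤ
R n = proj₁

private
  ∣m∣≤n : ∀ n (p : n ∈ 𝒫) → ∣ R n p ∣ ≤ n
  ∣m∣≤n n (m , eq) = lemma ∣ m ∣ refl
    where
    q = + 3 ℤ.* m ℤ.+ + 1

    eq′ : 2 * n ≡ ∣ m ∣ * ∣ q ∣
    eq′ = trans (sym (ℤ.abs-* (+ 2) (+ n))) (trans (cong ∣_∣ eq) (ℤ.abs-* m q))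

    q-1 : ∀ x → (+ 3 ℤ.* x ℤ.+ + 1) ℤ.- + 1 ≡ + 3 ℤ.* x
    q-1 = ℤ-Solver.solve-∀

    bound : 3 * ∣ m ∣ ≤ ∣ q ∣ + 1
    bound = begin
      3 * ∣ m ∣         ≡⟨ ℤ.abs-* (+ 3) m ⟨
      ∣ + 3 ℤ.* m ∣     ≡⟨ cong ∣_∣ (q-1 m) ⟨
      ∣ q ℤ.- + 1 ∣     ≤⟨ ℤ.∣i-j∣≤∣i∣+∣j∣ q (+ 1) ⟩
      ∣ q ∣ + 1         ∎
      where open ≤-Reasoning

    lemma : ∀ a → ∣ m ∣ ≡ a → a ≤ n
    lemma zero    _ = z≤n
    lemma (suc a) e = *-cancelˡ-≤ 2 (begin
      2 * suc a         ≡⟨ *-comm 2 (suc a) ⟩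
      suc a * 2         ≤⟨ *-monoʳ-≤ (suc a) 2≤q ⟩
      suc a * ∣ q ∣     ≡⟨ cong (_* ∣ q ∣) e ⟨
      ∣ m ∣ * ∣ q ∣     ≡⟨ eq′ ⟨
      2 * n             ∎)
      where
      open ≤-Reasoning
      2≤q : 2 ≤ ∣ q ∣
      2≤q = +-cancelʳ-≤ 1 2 ∣ q ∣
        (≤-trans (*-monoʳ-≤ 3 (s≤s z≤n)) (subst (λ b → 3 * b ≤ ∣ q ∣ + 1) e bound))

𝒫? : Decidable 𝒫
𝒫? n = map′ to from
  (anyUpTo? (λ k → root? (+ k)) (suc n) ⊎-dec anyUpTo? (λ k → root? (- + k)) (suc n))
  where
  Root : ℤ → Set
  Root m = + 2 ℤ.* + n ≡ m ℤ.* (+ 3 ℤ.* m ℤ.+ + 1)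

  root? : Decidable Root
  root? m = + 2 ℤ.* + n ℤ.≟ m ℤ.* (+ 3 ℤ.* m ℤ.+ + 1)

  Bounded : Set
  Bounded = (∃ λ k → k < suc n × Root (+ k)) ⊎ (∃ λ k → k < suc n × Root (- + k))

  to : Bounded → n ∈ 𝒫
  to (inj₁ (k , _ , eq)) = + k , eq
  to (inj₂ (k , _ , eq)) = - + k , eq

  from : n ∈ 𝒫 → Bounded
  from (+ k , eq)        = inj₁ (k , s≤s (∣m∣≤n n (+ k , eq)) , eq)
  from (ℤ.-[1+ k ] , eq) = inj₂ (suc k , s≤s (∣m∣≤n n (ℤ.-[1+ k ] , eq)) , eq)

-- The largest element of 𝒫 that is ≤ n, found by descending from n; see
-- `⌊⌋ₚ∈𝒫`, `⌊⌋ₚ≤` and `⌊⌋ₚ-greatest` below.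
⌊_⌋ₚ : ℕ → ℕ
⌊ zero ⌋ₚ  = zero
⌊ suc n ⌋ₚ = if does (𝒫? (suc n)) then suc n else ⌊ n ⌋ₚ

⌊⌋ₚ∈𝒫 : ∀ n → ⌊ n ⌋ₚ ∈ 𝒫
⌊⌋ₚ∈𝒫 zero    = 0ℤ , refl
⌊⌋ₚ∈𝒫 (suc n) = step (𝒫? (suc n))
  where
  step : (d : Dec (suc n ∈ 𝒫)) → (if does d then suc n else ⌊ n ⌋ₚ) ∈ 𝒫
  step (yes p) = p
  step (no  _) = ⌊⌋ₚ∈𝒫 n

⌊⌋ₚ≤ : ∀ n → ⌊ n ⌋ₚ ≤ n
⌊⌋ₚ≤ zero    = z≤n
⌊⌋ₚ≤ (suc n) = step (𝒫? (suc n))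
  where
  step : (d : Dec (suc n ∈ 𝒫)) → (if does d then suc n else ⌊ n ⌋ₚ) ≤ suc n
  step (yes _) = ≤-refl
  step (no  _) = m≤n⇒m≤1+n (⌊⌋ₚ≤ n)

⌊⌋ₚ-greatest : ∀ n {q} → q ∈ 𝒫 → q ≤ n → q ≤ ⌊ n ⌋ₚ
⌊⌋ₚ-greatest zero        _   q≤0   = q≤0
⌊⌋ₚ-greatest (suc n) {q} q∈𝒫 q≤1+n = step (𝒫? (suc n)) (m≤n⇒m<n∨m≡n q≤1+n)
  where
  step : (d : Dec (suc n ∈ 𝒫)) → q < suc n ⊎ q ≡ suc n → q ≤ (if does d then suc n else ⌊ n ⌋ₚ)
  step (yes _) _                = q≤1+n
  step (no  _) (inj₁ (s≤s q≤n)) = ⌊⌋ₚ-greatest n q∈𝒫 q≤n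
  step (no ¬p) (inj₂ q≡1+n)     = ⊥-elim (¬p (subst 𝒫 q≡1+n q∈𝒫))

R⌊_⌋ₚ : ℕ → ℤ
R⌊ n ⌋ₚ = R ⌊ n ⌋ₚ (⌊⌋ₚ∈𝒫 n)

R-unique : ∀ n (p q : n ∈ 𝒫) → R n p ≡ R n q
R-unique n (m , eq) (k , eq′) =
  [ ℤ.i-j≡0⇒i≡j m k , ⊥-elim ∘ 3x+1≢0 (m ℤ.+ k) ]′ (ℤ.i*j≡0⇒i≡0∨j≡0 (m ℤ.- k) product≡0)
  where
  factor : ∀ x y → (x ℤ.- y) ℤ.* (+ 3 ℤ.* (x ℤ.+ y) ℤ.+ + 1)
                   ≡ x ℤ.* (+ 3 ℤ.* x ℤ.+ + 1) ℤ.- y ℤ.* (+ 3 ℤ.* y ℤ.+ + 1)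
  factor = ℤ-Solver.solve-∀

  product≡0 : (m ℤ.- k) ℤ.* (+ 3 ℤ.* (m ℤ.+ k) ℤ.+ + 1) ≡ 0ℤ
  product≡0 = trans (factor m k) (ℤ.i≡j⇒i-j≡0 (trans (sym eq) eq′))

  3a≢1 : ∀ a → ¬ (a * 3 ≡ 1)
  3a≢1 zero    ()
  3a≢1 (suc a) ()

  shift : ∀ x → + 3 ℤ.* x ≡ (+ 3 ℤ.* x ℤ.+ + 1) ℤ.- + 1
  shift = ℤ-Solver.solve-∀

  3x+1≢0 : ∀ x → ¬ (+ 3 ℤ.* x ℤ.+ + 1 ≡ 0ℤ)
  3x+1≢0 x e = 3a≢1 ∣ x ∣ (begin
    ∣ x ∣ * 3                            ≡⟨ *-comm ∣ x ∣ 3 ⟩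
    3 * ∣ x ∣                            ≡⟨ ℤ.abs-* (+ 3) x ⟨
    ∣ + 3 ℤ.* x ∣                        ≡⟨ cong ∣_∣ (shift x) ⟩
    ∣ (+ 3 ℤ.* x ℤ.+ + 1) ℤ.- + 1 ∣      ≡⟨ cong (λ z → ∣ z ℤ.- + 1 ∣) e ⟩
    1                                    ∎)
    where open ≡-Reasoning

private
  Bounded : ℕ → List ℕ → Set
  Bounded k ps = All (0 <_) ps × All (_≤ k) ps × Linked _>_ ps

  cons-linked : ∀ {k ps} → All (_≤ k) ps → Linked _>_ ps → Linked _>_ (suc k ∷ ps)
  cons-linked []      _ = [-]
  cons-linked (p ∷ _) l = s≤s p ∷ l

  tail-bound : ∀ {x ps} → Linked _>_ (x ∷ ps) → All (_< x) ps
  tail-bound [-]     = []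
  tail-bound (r ∷ l) = r ∷ All.map (λ s → ≤-trans s (≤-trans (m≤n⇒m≤1+n ≤-refl) r)) (tail-bound l)

  upTo-sound : ∀ k {ps} → ps ∈ˡ distinctPartsUpTo k → Bounded k ps
  upTo-sound zero (here refl) = [] , [] , []
  upTo-sound (suc k) ps∈ with ∈-++⁻ (distinctPartsUpTo k) ps∈
  ... | inj₁ p with upTo-sound k p
  ...   | pos , bd , l = pos , All.map m≤n⇒m≤1+n bd , l
  upTo-sound (suc k) ps∈ | inj₂ p with ∈-map⁻ (suc k ∷_) p
  ... | qs , q , refl with upTo-sound k q
  ...   | pos , bd , l =
    s≤s z≤n ∷ pos , ≤-refl ∷ All.map m≤n⇒m≤1+n bd , cons-linked bd l

  upTo-complete : ∀ k {ps} → Bounded k ps → ps ∈ˡ distinctPartsUpTo k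
  upTo-complete zero {[]} _ = here refl
  upTo-complete zero {x ∷ ps} (s≤s _ ∷ _ , () ∷ _ , _)
  upTo-complete (suc k) {[]} _ = ∈-++⁺ˡ (upTo-complete k ([] , [] , []))
  upTo-complete (suc k) {x ∷ ps} (p ∷ pos , b ∷ bd , l) with m≤n⇒m<n∨m≡n b
  ... | inj₁ (s≤s x≤k) = ∈-++⁺ˡ (upTo-complete k
    (p ∷ pos , x≤k ∷ All.map (λ s → ≤-trans (m≤n⇒m≤1+n ≤-refl) (≤-trans s x≤k)) (tail-bound l) , l))
  ... | inj₂ refl = ∈-++⁺ʳ (distinctPartsUpTo k) (∈-map⁺ (suc k ∷_)
    (upTo-complete k (pos , All.map (λ { (s≤s s) → s }) (tail-bound l) , Linked.tail l)))

  upTo-unique : ∀ k → Unique (distinctPartsUpTo k)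
  upTo-unique zero    = [] ∷ []
  upTo-unique (suc k) = Unique.++⁺ (upTo-unique k) (Unique.map⁺ ∷-injectiveʳ (upTo-unique k)) disjoint
    where
    disjoint : ∀ {ps} → ¬ (ps ∈ˡ distinctPartsUpTo k × ps ∈ˡ map (suc k ∷_) (distinctPartsUpTo k))
    disjoint (p , q) with ∈-map⁻ (suc k ∷_) q
    ... | _ , _ , refl with upTo-sound k p
    ...   | _ , b ∷ _ , _ = <-irrefl refl b

  parts≤sum : ∀ ps → All (_≤ sum ps) ps
  parts≤sum []       = []
  parts≤sum (p ∷ ps) = m≤m+n p (sum ps) ∷ All.map (λ s → ≤-trans s (m≤n+m′ p)) (parts≤sum ps)
    where
    m≤n+m′ : ∀ a {b} → b ≤ a + b
    m≤n+m′ zero    = ≤-refl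
    m≤n+m′ (suc a) = m≤n⇒m≤1+n (m≤n+m′ a)

distinctPartitions-sound : ∀ {n ps} → ps ∈ˡ distinctPartitions n → ps IsDistinctPartitionOf n
distinctPartitions-sound {n} p with ∈-filter⁻ (λ ps → sum ps ≟ n) {xs = distinctPartsUpTo n} p
... | q , s with upTo-sound n q
...   | pos , _ , l = record { parts-positive = pos ; parts-decreasing = l ; parts-sum = s }

distinctPartitions-complete : ∀ {n ps} → ps IsDistinctPartitionOf n → ps ∈ˡ distinctPartitions n
distinctPartitions-complete {n} {ps} record { parts-positive = pos ; parts-decreasing = l ; parts-sum = s } =
  ∈-filter⁺ (λ qs → sum qs ≟ n)
    (upTo-complete n (pos , subst (λ k → All (_≤ k) ps) s (parts≤sum ps) , l)) s

distinctPartitions-unique : ∀ n → Unique (distinctPartitions n)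
distinctPartitions-unique n = Unique.filter⁺ (λ ps → sum ps ≟ n) (upTo-unique n)

-- The conditions of the successive cases of the formula; in the second one,
-- "not odd and positive" is the negation of "odd and positive".
Case₁ Case₂ Case₃ Case₄ Case₅ : Pred ℕ 0ℓ
Case₁ n = Σ (n ∈ 𝒫) λ n∈𝒫 → Odd (R n n∈𝒫) × Positive (R n n∈𝒫)
Case₂ n = Σ (n ∈ 𝒫) λ n∈𝒫 → ¬ (Odd (R n n∈𝒫) × Positive (R n n∈𝒫))
Case₃ n = n ∉ 𝒫 × (Odd R⌊ n ⌋ₚ × Positive R⌊ n ⌋ₚ) × n % 2 ≡ ⌊ n ⌋ₚ % 2
Case₄ n = n ∉ 𝒫 × (Even R⌊ n ⌋ₚ × Positive R⌊ n ⌋ₚ) × n % 2 ≡ ⌊ n ⌋ₚ % 2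
Case₅ n = n ∉ 𝒫 × (Even R⌊ n ⌋ₚ × Negative R⌊ n ⌋ₚ)

{-# OPTIONS --safe #-}

-- Removing the part 1 gives Mₑ(n) - Mₒ(n) = D(n) - E(n-1), where D and E run over
-- the partitions into distinct parts ≥ 2 with sign (-1)^(largest part), resp.
-- (-1)^(number of parts).  Multiplying by 1 + q, resp. 1 - q, restores the part 1:
-- (1 + q) D = G₁ + 2q and (1 - q) E = G₋₁, with G_y = 1 - q + y q² f₁ and
--   f_N = Σ_k (-y)ᵏ q^(Nk) Π_{j≤k} (1 + y q^(N+j)).
-- For y² = 1, Euler's rearrangement gives f_N = 1 - q^(2N+1) + y q^(3N+2) f_(N+1), so
--   G_y = Σ_N yᴺ q^(N(3N+1)/2) (1 - q^(2N+1)).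
-- This is the pentagonal number theorem for y = -1 and Fine's companion for y = 1.
-- Between consecutive pentagonal numbers E is therefore constant and D alternates
-- in sign, and the jumps at the pentagonal numbers determine both.
module Submission where

open import Data.Bool.Base using (true; false; if_then_else_)
open import Data.Integer.Base using (ℤ; +_; -[1+_]; -_; _-_; _*_; _^_; 0ℤ; 1ℤ; -1ℤ; +<+; -<+; +≤+) renaming (_+_ to _⊕_; _<_ to _<ᶻ_; _≤_ to _≤ᶻ_)
import Data.Integer.Properties as ℤ
open import Data.Integer.Tactic.RingSolver using (solve-∀)
open import Data.List.Base using (List; []; _∷_; _++_; length; map; filter)
open import Data.List.Extrema.Nat using (max; f[argmax]≈f[v]⁺)
open import Data.List.Properties using (filter-accept; filter-reject)
open import Data.List.Relation.Unary.All as All using (All; []; _∷_)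
import Data.List.Relation.Unary.All.Properties as All
open import Data.List.Relation.Unary.Any using (here)
open import Data.Nat.Base using (ℕ; zero; suc; _<_; _≤_; _∸_; _+_; z≤n; s≤s)
open import Data.Nat.DivMod using (_%_; [m+kn]%n≡m%n)
open import Data.Nat.Divisibility using (_∣_; divides; _∣0; ∣1⇒≡1; ∣m∣n⇒∣m+n; ∣m+n∣m⇒∣n; ∣-refl)
open import Data.Nat.ListAction using (sum)
import Data.Nat.Properties as ℕ
open import Data.List.Membership.DecPropositional ℕ._≟_ using (_∈?_)
open import Data.Product.Base using (_×_; _,_; proj₁; proj₂)
open import Data.Sum.Base using (_⊎_; inj₁; inj₂)
open import Function.Base using (_∘_; id)
open import Relation.Binary.PropositionalEquality using (_≡_; refl; sym; trans; cong; cong₂; subst; module ≡-Reasoning)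
open import Relation.Nullary.Decidable using (Dec; yes; no; does; dec-true; dec-false)
open import Relation.Nullary.Negation using (¬_; contradiction)
open import Relation.Unary using (_∈_; _∉_)
open import Defs

-- Power series and the pentagonal numbers.

-- A power series is its coefficient function, extended by 0 to negative
-- indices: multiplication by qᵃ is then n ↦ n - a, without truncation.
δ : ℤ → ℤ
δ (+ zero) = 1ℤ
δ _        = 0ℤ

δ-neg : ∀ {i} → i <ᶻ 0ℤ → δ i ≡ 0ℤ
δ-neg -<+ = refl
δ-neg (+<+ ())

neg-minus-nonNeg : ∀ {i} k → i <ᶻ 0ℤ → i - + k <ᶻ 0ℤ
neg-minus-nonNeg {i} k i<0 = ℤ.≤-<-trans (ℤ.i-j≤i i (+ k)) i<0

<⇒minus-neg : ∀ {i j} → i <ᶻ j → i - j <ᶻ 0ℤ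
<⇒minus-neg {i} {j} i<j = subst (i - j <ᶻ_) (ℤ.+-inverseʳ j) (ℤ.+-monoˡ-< (- j) i<j)

-- p N = N(3N+1)/2, the pentagonal number with R = N.  The pentagonal numbers in
-- [p N, p (N+1)) are p N and p N + (2N+1), the latter with R = -(N+1).
p : ℕ → ℕ
p zero    = 0
p (suc N) = p N + (2 + (N + N + N))

-- Euler's rearrangement for y² = 1.

module Euler (y : ℤ) (y²≡1 : y * y ≡ 1ℤ) where

  -- The ring solver knows nothing of y² = 1, so an identity modulo y² - 1 is handed to it with an
  -- explicit cofactor `z`.
  modulo-y² : ∀ {l r} z → l ≡ r ⊕ (y * y - 1ℤ) * z → l ≡ r
  modulo-y² {l} {r} z eq = trans eq (trans (cong (λ u → r ⊕ (u - 1ℤ) * z) y²≡1) (ℤ.+-identityʳ r))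

  -- W N k = Π_{j<k} (1 + y q^(N+j))
  W : ℕ → ℕ → ℤ → ℤ
  W N zero    n = δ n
  W N (suc k) n = W N k n ⊕ y * W N k (n - + (k + N))

  W-neg : ∀ N k {n} → n <ᶻ 0ℤ → W N k n ≡ 0ℤ
  W-neg N zero    n<0 = δ-neg n<0
  W-neg N (suc k) n<0 = trans
    (cong₂ (λ u v → u ⊕ y * v) (W-neg N k n<0) (W-neg N k (neg-minus-nonNeg (k + N) n<0)))
    (trans (ℤ.+-identityˡ (y * 0ℤ)) (ℤ.*-zeroʳ y))

  -- `W` grows by its last factor; splitting off the first one, 1 + y q^N, is what lets the products
  -- for N and N + 1 be compared.
  W-first : ∀ N k n → W N (suc k) n ≡ W (suc N) k n ⊕ y * W (suc N) k (n - + N)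
  W-first N zero    n = refl
  W-first N (suc k) n = begin
    W N (suc k) n ⊕ y * W N (suc k) (n - (1ℤ ⊕ + k ⊕ + N))
      ≡⟨ cong₂ (λ u v → u ⊕ y * v) (W-first N k n) (W-first N k _) ⟩
    (A ⊕ y * B) ⊕ y * (W (suc N) k (n - (1ℤ ⊕ + k ⊕ + N)) ⊕ y * W (suc N) k (n - (1ℤ ⊕ + k ⊕ + N) - + N))
      ≡⟨ cong₂ (λ i j → (A ⊕ y * B) ⊕ y * (W (suc N) k i ⊕ y * W (suc N) k j)) (e₁ n (+ k) (+ N)) (e₂ n (+ k) (+ N)) ⟩
    (A ⊕ y * B) ⊕ y * (C ⊕ y * E)
      ≡⟨ e₃ A B C E y ⟩
    (A ⊕ y * C) ⊕ y * (B ⊕ y * E) ∎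
    where
    open ≡-Reasoning
    A = W (suc N) k n
    B = W (suc N) k (n - + N)
    C = W (suc N) k (n - + (k + suc N))
    E = W (suc N) k (n - + N - + (k + suc N))
    e₁ : ∀ n k N → n - (1ℤ ⊕ k ⊕ N) ≡ n - (k ⊕ (1ℤ ⊕ N))
    e₁ = solve-∀
    e₂ : ∀ n k N → n - (1ℤ ⊕ k ⊕ N) - N ≡ n - N - (k ⊕ (1ℤ ⊕ N))
    e₂ = solve-∀
    e₃ : ∀ a b c e y → (a ⊕ y * b) ⊕ y * (c ⊕ y * e) ≡ (a ⊕ y * c) ⊕ y * (b ⊕ y * e)
    e₃ = solve-∀

  -- f N K = Σ_{k<K} (-y)ᵏ q^(Nk) W N (k+1)
  f : ℕ → ℕ → ℤ → ℤ
  f N zero    n = 0ℤ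
  f N (suc K) n = f N K n ⊕ (- y) ^ K * W N (suc K) (n - + N * + K)

  -- h K N = 1 - q^(2N+1) + y q^(3N+2) f (N+1) K
  h : ℕ → ℕ → ℤ → ℤ
  h K N n = δ n - δ (n - + (suc (N + N))) ⊕ y * f (suc N) K (n - + (2 + (N + N + N)))

  -- Splitting 1 + y q^N off each summand leaves two multiples of products `W (suc N)`. The second
  -- one cancels against the next summand, up to the last factor of the latter's product; what
  -- survives is, as y² = 1, a summand of y q^(3N+2) f (N+1). The subtracted term is the part still
  -- waiting for its successor.
  f-telescoped : ∀ N K n → f N (2 + K) n ≡
    h K N n - (- y) ^ (2 + K) * W (suc N) (suc K) (n - + N * + (2 + K))
  f-telescoped N zero n = begin
    f N 2 n
      ≡⟨ cong (λ i → 0ℤ ⊕ 1ℤ * (δ i ⊕ y * δ (i - + N)) ⊕ (- y) ^ 1 * W N 2 (n - + N * + 1)) (i₀ n (+ N)) ⟩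
    0ℤ ⊕ 1ℤ * (δ n ⊕ y * a) ⊕ (- y) ^ 1 * W N 2 (n - + N * + 1)
      ≡⟨ cong (λ i → 0ℤ ⊕ 1ℤ * (δ n ⊕ y * a) ⊕ (- y) ^ 1 * W N 2 i) (i₁ n (+ N)) ⟩
    0ℤ ⊕ 1ℤ * (δ n ⊕ y * a) ⊕ (- y) ^ 1 * ((a ⊕ y * b) ⊕ y * (δ (n - + N - (1ℤ ⊕ + N)) ⊕ y * δ (n - + N - (1ℤ ⊕ + N) - + N)))
      ≡⟨ cong₂ (λ i j → 0ℤ ⊕ 1ℤ * (δ n ⊕ y * a) ⊕ (- y) ^ 1 * ((a ⊕ y * b) ⊕ y * (δ i ⊕ y * δ j))) (i₂ n (+ N)) (i₃ n (+ N)) ⟩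
    0ℤ ⊕ 1ℤ * (δ n ⊕ y * a) ⊕ (- y) ^ 1 * ((a ⊕ y * b) ⊕ y * (c ⊕ y * e))
      -- The summand - y y c turns into - c, the coefficient of - q^(2N+1).
      ≡⟨ modulo-y² (- c) (alg y (δ n) a b c e) ⟩
    (δ n - c ⊕ y * 0ℤ) - (- y) ^ 2 * (b ⊕ y * e)
      ≡⟨ cong₂ (λ i j → (δ n - c ⊕ y * 0ℤ) - (- y) ^ 2 * (δ i ⊕ y * δ j)) (i₄ n (+ N)) (i₅ n (+ N)) ⟩
    h 0 N n - (- y) ^ 2 * W (suc N) 1 (n - + N * + 2) ∎
    where
    open ≡-Reasoning
    a = δ (n - + N)
    b = δ (n - + N - + N)
    c = δ (n - + (suc (N + N)))
    e = δ (n - + (suc (N + N)) - + N)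
    i₀ : ∀ n N → n - N * 0ℤ ≡ n
    i₀ = solve-∀
    i₁ : ∀ n N → n - N * 1ℤ ≡ n - N
    i₁ = solve-∀
    i₂ : ∀ n N → n - N - (1ℤ ⊕ N) ≡ n - (1ℤ ⊕ (N ⊕ N))
    i₂ = solve-∀
    i₃ : ∀ n N → n - N - (1ℤ ⊕ N) - N ≡ n - (1ℤ ⊕ (N ⊕ N)) - N
    i₃ = solve-∀
    i₄ : ∀ n N → n - N - N ≡ n - N * + 2
    i₄ = solve-∀
    i₅ : ∀ n N → n - (1ℤ ⊕ (N ⊕ N)) - N ≡ n - N * + 2 - (1ℤ ⊕ N)
    i₅ = solve-∀
    alg : ∀ y d a b c e →
      0ℤ ⊕ 1ℤ * (d ⊕ y * a) ⊕ (- y * 1ℤ) * ((a ⊕ y * b) ⊕ y * (c ⊕ y * e)) ≡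
      ((d - c ⊕ y * 0ℤ) - (- y * (- y * 1ℤ)) * (b ⊕ y * e)) ⊕ (y * y - 1ℤ) * (- c)
    alg = solve-∀
  f-telescoped N (suc K) n = begin
    f N (2 + K) n ⊕ (- y) ^ (2 + K) * W N (3 + K) m
      ≡⟨ cong₂ (λ i j → i ⊕ (- y) ^ (2 + K) * j) (f-telescoped N K n) (W-first N (2 + K) m) ⟩
    (h K N n - (- y) ^ (2 + K) * u) ⊕ (- y) ^ (2 + K) * ((u ⊕ y * v) ⊕ y * W (suc N) (2 + K) (m - + N))
      ≡⟨ cong (λ i → (h K N n - (- y) ^ (2 + K) * u) ⊕ (- y) ^ (2 + K) * ((u ⊕ y * v) ⊕ y * W (suc N) (2 + K) i)) (i₁ n (+ N) (+ K)) ⟩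
    (h K N n - (- y) ^ (2 + K) * u) ⊕ (- y) ^ (2 + K) * ((u ⊕ y * v) ⊕ y * w)
      -- The two `u` cancel, `v` supplies summand `K` of f (N+1), and `w` is the new pending term.
      ≡⟨ modulo-y² (y * (- y) ^ K * v) (alg y (δ n) (δ (n - + (suc (N + N)))) F ((- y) ^ K) u v w) ⟩
    (δ n - δ (n - + (suc (N + N))) ⊕ y * (F ⊕ (- y) ^ K * v)) - (- y) ^ (3 + K) * w
      ≡⟨ cong (λ i → (δ n - δ (n - + (suc (N + N))) ⊕ y * (F ⊕ (- y) ^ K * W (suc N) (suc K) i)) - (- y) ^ (3 + K) * w) (i₂ n (+ N) (+ K)) ⟩
    h (suc K) N n - (- y) ^ (3 + K) * w ∎
    where
    open ≡-Reasoning
    m = n - + N * + (2 + K)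
    u = W (suc N) (suc K) m
    v = W (suc N) (suc K) (m - + (suc K + suc N))
    w = W (suc N) (2 + K) (n - + N * + (3 + K))
    F = f (suc N) K (n - + (2 + (N + N + N)))
    i₁ : ∀ n N K → n - N * (+ 2 ⊕ K) - N ≡ n - N * (+ 3 ⊕ K)
    i₁ = solve-∀
    i₂ : ∀ n N K → n - N * (+ 2 ⊕ K) - (1ℤ ⊕ K ⊕ (1ℤ ⊕ N)) ≡ n - (+ 2 ⊕ (N ⊕ N ⊕ N)) - (1ℤ ⊕ N) * K
    i₂ = solve-∀
    alg : ∀ y d c F P u v w →
      ((d - c ⊕ y * F) - (- y * (- y * P)) * u) ⊕ (- y * (- y * P)) * ((u ⊕ y * v) ⊕ y * w) ≡
      ((d - c ⊕ y * (F ⊕ P * v)) - (- y * (- y * (- y * P))) * w) ⊕ (y * y - 1ℤ) * (y * P * v)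
    alg = solve-∀

  minus-multiple-neg : ∀ N {K n} → n <ᶻ + K → n - + suc N * + K <ᶻ 0ℤ
  minus-multiple-neg N {K} {n} n<K = <⇒minus-neg (ℤ.<-≤-trans n<K
    (subst (+ K ≤ᶻ_) (ℤ.pos-* (suc N) K) (+≤+ (ℕ.m≤m+n K _))))

  -- Summand `K` starts at q^((N+1)K), beyond degree n < K. Hence the truncation is exact in low
  -- degrees.
  f-stable : ∀ N K {n} → n <ᶻ + K → f (suc N) (suc K) n ≡ f (suc N) K n
  f-stable N K {n} n<K = begin
    f (suc N) K n ⊕ (- y) ^ K * W (suc N) (suc K) (n - + suc N * + K)
      ≡⟨ cong (λ w → f (suc N) K n ⊕ (- y) ^ K * w) (W-neg (suc N) (suc K) (minus-multiple-neg N n<K)) ⟩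
    f (suc N) K n ⊕ (- y) ^ K * 0ℤ
      ≡⟨ cong (f (suc N) K n ⊕_) (ℤ.*-zeroʳ ((- y) ^ K)) ⟩
    f (suc N) K n ⊕ 0ℤ
      ≡⟨ ℤ.+-identityʳ _ ⟩
    f (suc N) K n ∎
    where open ≡-Reasoning

  -- In degrees below `K` neither the two additional summands nor the pending term of `f-telescoped`
  -- contributes.
  f≡h : ∀ N K {n} → n <ᶻ + K → f (suc N) K n ≡ h K (suc N) n
  f≡h N K {n} n<K = begin
    f (suc N) K n
      ≡⟨ f-stable N K n<K ⟨
    f (suc N) (1 + K) n
      ≡⟨ f-stable N (1 + K) n<1+K ⟨
    f (suc N) (2 + K) n
      ≡⟨ f-telescoped (suc N) K n ⟩
    h K (suc N) n - (- y) ^ (2 + K) * W (2 + N) (suc K) (n - + suc N * + (2 + K))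
      ≡⟨ cong (λ w → h K (suc N) n - (- y) ^ (2 + K) * w) (W-neg (2 + N) (suc K) (minus-multiple-neg N n<2+K)) ⟩
    h K (suc N) n - (- y) ^ (2 + K) * 0ℤ
      ≡⟨ cong (λ w → h K (suc N) n - w) (ℤ.*-zeroʳ ((- y) ^ (2 + K))) ⟩
    h K (suc N) n ⊕ 0ℤ
      ≡⟨ ℤ.+-identityʳ _ ⟩
    h K (suc N) n ∎
    where
    open ≡-Reasoning
    n<1+K = ℤ.<-trans n<K (+<+ (ℕ.n<1+n K))
    n<2+K = ℤ.<-trans n<1+K (+<+ (ℕ.n<1+n (suc K)))

  f-neg : ∀ N K {n} → n <ᶻ 0ℤ → f (suc N) K n ≡ 0ℤ
  f-neg N zero    n<0 = refl
  f-neg N (suc K) n<0 =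
    trans (f-stable N K (ℤ.<-≤-trans n<0 (+≤+ z≤n))) (f-neg N K n<0)

  -- `f≡h` iterated N times: each round multiplies by y and shifts by 3N + 2 = p (N+1) - p N. The
  -- bound is 2 + K because `h K 0` contains f 1 K shifted by q².
  h-block : ∀ K N t → p N + t < 2 + K → h K 0 (+ (p N + t)) ≡ y ^ N * h K N (+ t)
  h-block K zero    t _  = sym (ℤ.*-identityˡ _)
  h-block K (suc N) t lt = begin
    h K 0 (+ (p N + g + t))
      ≡⟨ cong (λ i → h K 0 (+ i)) (ℕ.+-assoc (p N) g t) ⟩
    h K 0 (+ (p N + (g + t)))
      ≡⟨ h-block K N (g + t) (subst (_< 2 + K) (ℕ.+-assoc (p N) g t) lt) ⟩
    y ^ N * (0ℤ - δ (+ (g + t) - + suc (N + N)) ⊕ y * f (suc N) K (+ (g + t) - + g))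
      -- The remaining δ vanishes too, since its index N + 1 + t is positive.
      ≡⟨ cong₂ (λ i j → y ^ N * (0ℤ - δ i ⊕ y * f (suc N) K j)) (i₁ (+ N) (+ t)) (i₂ (+ g) (+ t)) ⟩
    y ^ N * (0ℤ ⊕ y * f (suc N) K (+ t))
      ≡⟨ cong (λ u → y ^ N * (0ℤ ⊕ y * u)) (f≡h N K (+<+ t<K)) ⟩
    y ^ N * (0ℤ ⊕ y * h K (suc N) (+ t))
      ≡⟨ alg (y ^ N) y _ ⟩
    y ^ suc N * h K (suc N) (+ t) ∎
    where
    open ≡-Reasoning
    g = 2 + (N + N + N)
    t<K : t < K
    t<K = ℕ.+-cancelˡ-< 2 t K (ℕ.≤-<-trans (ℕ.+-monoˡ-≤ t (ℕ.≤-trans (s≤s (s≤s z≤n)) (ℕ.m≤n+m g (p N)))) lt)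
    i₁ : ∀ N t → + 2 ⊕ (N ⊕ N ⊕ N) ⊕ t - (1ℤ ⊕ (N ⊕ N)) ≡ 1ℤ ⊕ (N ⊕ t)
    i₁ = solve-∀
    i₂ : ∀ g t → g ⊕ t - g ≡ t
    i₂ = solve-∀
    alg : ∀ Y y u → Y * (0ℤ ⊕ y * u) ≡ y * Y * u
    alg = solve-∀

  -- The tail y q^(3N+2) f (N+1) only starts with the next block.
  h-gap : ∀ K N {t} → t < 2 + (N + N + N) → h K N (+ t) ≡ δ (+ t) - δ (+ t - + suc (N + N))
  h-gap K N {t} t<g = trans
    (cong (λ u → δ (+ t) - δ (+ t - + suc (N + N)) ⊕ y * u) (f-neg N K (<⇒minus-neg (+<+ t<g))))
    (alg (δ (+ t) - δ (+ t - + suc (N + N))) y)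
    where
    alg : ∀ a y → a ⊕ y * 0ℤ ≡ a
    alg = solve-∀

  h-first : ∀ K N → p N + 0 < 2 + K → h K 0 (+ (p N + 0)) ≡ y ^ N
  h-first K N lt = begin
    h K 0 (+ (p N + 0))  ≡⟨ h-block K N 0 lt ⟩
    y ^ N * h K N 0ℤ     ≡⟨ cong (y ^ N *_) (h-gap K N (s≤s z≤n)) ⟩
    y ^ N * 1ℤ           ≡⟨ ℤ.*-identityʳ _ ⟩
    y ^ N                ∎
    where open ≡-Reasoning

  h-first-gap : ∀ K N {t} → suc t ≤ N + N → p N + suc t < 2 + K → h K 0 (+ (p N + suc t)) ≡ 0ℤ
  h-first-gap K N {t} t< lt = begin
    h K 0 (+ (p N + suc t))                          ≡⟨ h-block K N (suc t) lt ⟩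
    y ^ N * h K N (+ suc t)                          ≡⟨ cong (y ^ N *_) (h-gap K N (s≤s (ℕ.m≤n⇒m≤1+n (ℕ.≤-trans t< (ℕ.m≤m+n _ N))))) ⟩
    y ^ N * (0ℤ - δ (+ suc t - + suc (N + N)))       ≡⟨ cong (λ u → y ^ N * (0ℤ - u)) (δ-neg (<⇒minus-neg (+<+ (s≤s t<)))) ⟩
    y ^ N * 0ℤ                                       ≡⟨ ℤ.*-zeroʳ (y ^ N) ⟩
    0ℤ                                               ∎
    where open ≡-Reasoning

  private
    mid+t<gap : ∀ N {t} → t ≤ N → suc (N + N) + t < 2 + (N + N + N)
    mid+t<gap N t≤N = s≤s (s≤s (ℕ.+-monoʳ-≤ (N + N) t≤N))

    i+j-i≡j : ∀ i j → i ⊕ j - i ≡ j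
    i+j-i≡j = solve-∀

  h-second : ∀ K N → p N + (suc (N + N) + 0) < 2 + K → h K 0 (+ (p N + (suc (N + N) + 0))) ≡ - (y ^ N)
  h-second K N lt = begin
    h K 0 (+ (p N + (suc (N + N) + 0)))                      ≡⟨ h-block K N (suc (N + N) + 0) lt ⟩
    y ^ N * h K N (+ (suc (N + N) + 0))                      ≡⟨ cong (y ^ N *_) (h-gap K N (mid+t<gap N z≤n)) ⟩
    y ^ N * (0ℤ - δ (+ (suc (N + N) + 0) - + suc (N + N)))   ≡⟨ cong (λ i → y ^ N * (0ℤ - δ i)) (i+j-i≡j (+ suc (N + N)) 0ℤ) ⟩
    y ^ N * -1ℤ                                              ≡⟨ alg (y ^ N) ⟩
    - (y ^ N)                                                ∎
    where
    open ≡-Reasoning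
    alg : ∀ Y → Y * -1ℤ ≡ - Y
    alg = solve-∀

  h-second-gap : ∀ K N {t} → suc t ≤ N → p N + (suc (N + N) + suc t) < 2 + K →
    h K 0 (+ (p N + (suc (N + N) + suc t))) ≡ 0ℤ
  h-second-gap K N {t} t< lt = begin
    h K 0 (+ (p N + (suc (N + N) + suc t)))                      ≡⟨ h-block K N (suc (N + N) + suc t) lt ⟩
    y ^ N * h K N (+ (suc (N + N) + suc t))                      ≡⟨ cong (y ^ N *_) (h-gap K N (mid+t<gap N t<)) ⟩
    y ^ N * (0ℤ - δ (+ (suc (N + N) + suc t) - + suc (N + N)))   ≡⟨ cong (λ i → y ^ N * (0ℤ - δ i)) (i+j-i≡j (+ suc (N + N)) (+ suc t)) ⟩
    y ^ N * 0ℤ                                                   ≡⟨ ℤ.*-zeroʳ (y ^ N) ⟩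
    0ℤ                                                           ∎
    where open ≡-Reasoning

module Euler⁺ = Euler 1ℤ refl
module Euler⁻ = Euler -1ℤ refl

-- The series D and E of partitions without the part 1.

-- For partitions into distinct parts from {2, …, K+1}, E K counts them with
-- sign (-1)^(number of parts) and D K with sign (-1)^(largest part).
E D : ℕ → ℤ → ℤ
E K n = Euler⁻.W 2 K n

D zero    n = δ n
D (suc k) n = D k n ⊕ -1ℤ ^ (2 + k) * Euler⁺.W 2 k (n - + (2 + k))

-- The factor 1 - q completes the product to Π (1 - q^j) from j = 1. Its successive partial products
-- differ by - q^(k+2) W 1 (k+1), which is summand k of - q² f 1 because (-y)^k = 1.
E-difference : ∀ K n → E K n - E K (n - 1ℤ) ≡ Euler⁻.h K 0 n
E-difference K n = begin
  E K n - E K (n - 1ℤ)            ≡⟨ cong (E K n ⊕_) (sym (ℤ.-1*i≡-i _)) ⟩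
  E K n ⊕ -1ℤ * E K (n - 1ℤ)      ≡⟨ Euler⁻.W-first 1 K n ⟨
  Euler⁻.W 1 (suc K) n                ≡⟨ expand K ⟩
  Euler⁻.h K 0 n                      ∎
  where
  open ≡-Reasoning
  alg : ∀ a F w → a ⊕ -1ℤ * F ⊕ -1ℤ * w ≡ a ⊕ -1ℤ * (F ⊕ 1ℤ * w)
  alg = solve-∀
  alg₀ : ∀ a b → a ⊕ -1ℤ * b ≡ a - b ⊕ 0ℤ
  alg₀ = solve-∀
  i₁ : ∀ n k → n - (1ℤ ⊕ k ⊕ 1ℤ) ≡ n - + 2 - 1ℤ * k
  i₁ = solve-∀
  1^k : ∀ k → 1ℤ ^ k ≡ 1ℤ
  1^k = ℤ.^-zeroˡ
  expand : ∀ k → Euler⁻.W 1 (suc k) n ≡ Euler⁻.h k 0 n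
  expand zero    = alg₀ (δ n) (δ (n - 1ℤ))
  expand (suc k) = begin
    Euler⁻.W 1 (suc k) n ⊕ -1ℤ * Euler⁻.W 1 (suc k) (n - + (suc k + 1))
      ≡⟨ cong₂ (λ u i → u ⊕ -1ℤ * Euler⁻.W 1 (suc k) i) (expand k) (i₁ n (+ k)) ⟩
    Euler⁻.h k 0 n ⊕ -1ℤ * Euler⁻.W 1 (suc k) (n - + 2 - 1ℤ * + k)
      ≡⟨ alg (δ n - δ (n - 1ℤ)) (Euler⁻.f 1 k (n - + 2)) _ ⟩
    δ n - δ (n - 1ℤ) ⊕ -1ℤ * (Euler⁻.f 1 k (n - + 2) ⊕ 1ℤ * Euler⁻.W 1 (suc k) (n - + 2 - 1ℤ * + k))
      ≡⟨ cong (λ u → δ n - δ (n - 1ℤ) ⊕ -1ℤ * (Euler⁻.f 1 k (n - + 2) ⊕ u * Euler⁻.W 1 (suc k) (n - + 2 - 1ℤ * + k))) (1^k k) ⟨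
    Euler⁻.h (suc k) 0 n ∎

-- The factor 1 + q completes the product behind the largest part k + 2 to `W 1 (suc k)`, giving a
-- summand of q² f 1. The empty partition gives 1 + q = (1 - q) + 2q, whence the correction.
D-sum : ∀ K n → D K n ⊕ D K (n - 1ℤ) ≡ Euler⁺.h K 0 n ⊕ + 2 * δ (n - 1ℤ)
D-sum zero    n = alg (δ n) (δ (n - 1ℤ))
  where
  alg : ∀ a b → a ⊕ b ≡ (a - b ⊕ 0ℤ) ⊕ + 2 * b
  alg = solve-∀
D-sum (suc k) n = begin
  (D k n ⊕ s * u) ⊕ (D k (n - 1ℤ) ⊕ s * Euler⁺.W 2 k (n - 1ℤ - + (2 + k)))
    ≡⟨ cong₂ (λ i j → (D k n ⊕ s * Euler⁺.W 2 k i) ⊕ (D k (n - 1ℤ) ⊕ s * Euler⁺.W 2 k j)) (i₁ n (+ k)) (i₂ n (+ k)) ⟩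
  (D k n ⊕ s * Euler⁺.W 2 k m) ⊕ (D k (n - 1ℤ) ⊕ s * Euler⁺.W 2 k (m - 1ℤ))
    ≡⟨ alg₁ (D k n) (D k (n - 1ℤ)) (-1ℤ ^ k) (Euler⁺.W 2 k m) (Euler⁺.W 2 k (m - 1ℤ)) ⟩
  D k n ⊕ D k (n - 1ℤ) ⊕ -1ℤ ^ k * (Euler⁺.W 2 k m ⊕ 1ℤ * Euler⁺.W 2 k (m - 1ℤ))
    ≡⟨ cong₂ (λ a b → a ⊕ -1ℤ ^ k * b) (D-sum k n) (sym (Euler⁺.W-first 1 k m)) ⟩
  Euler⁺.h k 0 n ⊕ + 2 * δ (n - 1ℤ) ⊕ -1ℤ ^ k * Euler⁺.W 1 (suc k) m
    ≡⟨ alg₂ (δ n - δ (n - 1ℤ)) (Euler⁺.f 1 k (n - + 2)) (δ (n - 1ℤ)) (-1ℤ ^ k * Euler⁺.W 1 (suc k) m) ⟩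
  Euler⁺.h (suc k) 0 n ⊕ + 2 * δ (n - 1ℤ) ∎
  where
  open ≡-Reasoning
  s = -1ℤ ^ (2 + k)
  u = Euler⁺.W 2 k (n - + (2 + k))
  m = n - + 2 - 1ℤ * + k
  i₁ : ∀ n k → n - (+ 2 ⊕ k) ≡ n - + 2 - 1ℤ * k
  i₁ = solve-∀
  i₂ : ∀ n k → n - 1ℤ - (+ 2 ⊕ k) ≡ n - + 2 - 1ℤ * k - 1ℤ
  i₂ = solve-∀
  alg₁ : ∀ a b s u v → (a ⊕ -1ℤ * (-1ℤ * s) * u) ⊕ (b ⊕ -1ℤ * (-1ℤ * s) * v) ≡ a ⊕ b ⊕ s * (u ⊕ 1ℤ * v)
  alg₁ = solve-∀
  alg₂ : ∀ a F d w → (a ⊕ 1ℤ * F) ⊕ + 2 * d ⊕ w ≡ (a ⊕ 1ℤ * (F ⊕ w)) ⊕ + 2 * d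
  alg₂ = solve-∀

D-neg : ∀ K {n} → n <ᶻ 0ℤ → D K n ≡ 0ℤ
D-neg zero    n<0 = δ-neg n<0
D-neg (suc k) n<0 = trans
  (cong₂ (λ u v → u ⊕ -1ℤ ^ (2 + k) * v) (D-neg k n<0) (Euler⁺.W-neg 2 k (neg-minus-nonNeg (2 + k) n<0)))
  (trans (ℤ.+-identityˡ _) (ℤ.*-zeroʳ (-1ℤ ^ (2 + k))))

x-y≡z⇒x≡z+y : ∀ x y {z} → x - y ≡ z → x ≡ z ⊕ y
x-y≡z⇒x≡z+y x y eq = trans (alg x y) (cong (_⊕ y) eq)
  where
  alg : ∀ x y → x ≡ x - y ⊕ y
  alg = solve-∀

x+y≡z⇒x≡z-y : ∀ x y {z} → x ⊕ y ≡ z → x ≡ z - y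
x+y≡z⇒x≡z-y x y eq = trans (alg x y) (cong (λ u → u - y) eq)
  where
  alg : ∀ x y → x ≡ x ⊕ y - y
  alg = solve-∀

E-step : ∀ K {m n} → n ≡ suc m → E K (+ n) ≡ Euler⁻.h K 0 (+ n) ⊕ E K (+ m)
E-step K {m} refl = x-y≡z⇒x≡z+y (E K (+ suc m)) (E K (+ m)) (E-difference K (+ suc m))

-- The condition 0 < m keeps n away from 1, where the correction 2q of `D-sum` contributes.
D-step : ∀ K {m n} → n ≡ suc m → 0 < m → D K (+ n) ≡ Euler⁺.h K 0 (+ n) - D K (+ m)
D-step K {suc m} refl _ = x+y≡z⇒x≡z-y (D K (+ suc (suc m))) (D K (+ suc m))
  (trans (D-sum K (+ suc (suc m))) (ℤ.+-identityʳ (Euler⁺.h K 0 (+ suc (suc m)))))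

E₀ : ∀ K → E K 0ℤ ≡ 1ℤ
E₀ K = begin
  E K 0ℤ                  ≡⟨ x-y≡z⇒x≡z+y (E K 0ℤ) (E K -1ℤ) (E-difference K 0ℤ) ⟩
  Euler⁻.h K 0 0ℤ ⊕ E K -1ℤ   ≡⟨ cong₂ _⊕_ (Euler⁻.h-first K 0 (s≤s z≤n)) (Euler⁻.W-neg 2 K -<+) ⟩
  1ℤ                      ∎
  where open ≡-Reasoning

D₁ : ∀ K → D K 1ℤ ≡ 0ℤ
D₁ K = begin
  D K 1ℤ                          ≡⟨ x+y≡z⇒x≡z-y (D K 1ℤ) (D K 0ℤ) (D-sum K 1ℤ) ⟩
  Euler⁺.h K 0 1ℤ ⊕ + 2 - D K 0ℤ      ≡⟨ cong₂ (λ a b → a ⊕ + 2 - b) (Euler⁺.h-second K 0 (s≤s (s≤s z≤n))) D₀ ⟩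
  0ℤ                              ∎
  where
  open ≡-Reasoning
  D₀ : D K 0ℤ ≡ 1ℤ
  D₀ = begin
    D K 0ℤ                          ≡⟨ x+y≡z⇒x≡z-y (D K 0ℤ) (D K -1ℤ) (D-sum K 0ℤ) ⟩
    Euler⁺.h K 0 0ℤ ⊕ 0ℤ - D K -1ℤ      ≡⟨ cong₂ (λ a b → a ⊕ 0ℤ - b) (Euler⁺.h-first K 0 (s≤s z≤n)) (D-neg K -<+) ⟩
    1ℤ                              ∎

-- Values of E and D between consecutive pentagonal numbers.

p-second-pred : ∀ N → p N + (suc (N + N) + 0) ≡ suc (p N + (N + N))
p-second-pred N = trans (cong (λ i → p N + i) (ℕ.+-identityʳ (suc (N + N)))) (ℕ.+-suc (p N) (N + N))

p-first-pred : ∀ N → p (suc N) + 0 ≡ suc (p N + (suc (N + N) + N))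
p-first-pred N = trans (ℕ.+-identityʳ (p (suc N))) (ℕ.+-suc (p N) (suc (N + N + N)))

p-second-suc : ∀ N t → p N + (suc (N + N) + suc t) ≡ suc (p N + (suc (N + N) + t))
p-second-suc N t = trans (cong (λ i → p N + i) (ℕ.+-suc (suc (N + N)) t)) (ℕ.+-suc (p N) (suc (N + N) + t))

<-pred : ∀ {m n o} → n ≡ suc m → n < o → m < o
<-pred refl = ℕ.<-trans (ℕ.n<1+n _)

module _ (K : ℕ) where

  -- E accumulates the coefficients of `h`: it jumps by (-1)^N at p N, by the opposite amount at p N
  -- + 2N + 1, and stays put elsewhere. The induction walks from each number to its predecessor.
  E-first : ∀ N t → t ≤ N + N → p N + t < 2 + K → E K (+ (p N + t)) ≡ -1ℤ ^ N
  E-second : ∀ N t → t ≤ N → p N + (suc (N + N) + t) < 2 + K → E K (+ (p N + (suc (N + N) + t))) ≡ 0ℤ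

  E-first zero    zero    _  lt = E₀ K
  E-first (suc N) zero    _  lt = trans (E-step K (p-first-pred N))
    (trans (cong₂ _⊕_ (Euler⁻.h-first K (suc N) lt) (E-second N N ℕ.≤-refl (<-pred (p-first-pred N) lt)))
      (ℤ.+-identityʳ _))
  E-first N       (suc t) t≤ lt = trans (E-step K (ℕ.+-suc (p N) t))
    (trans (cong₂ _⊕_ (Euler⁻.h-first-gap K N t≤ lt) (E-first N t (ℕ.<⇒≤ t≤) (<-pred (ℕ.+-suc (p N) t) lt)))
      (ℤ.+-identityˡ _))
  E-second N zero    _  lt = trans (E-step K (p-second-pred N))
    (trans (cong₂ _⊕_ (Euler⁻.h-second K N lt) (E-first N (N + N) ℕ.≤-refl (<-pred (p-second-pred N) lt)))
      (ℤ.+-inverseˡ (-1ℤ ^ N)))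
  E-second N (suc t) t≤ lt = trans (E-step K (p-second-suc N t))
    (trans (cong₂ _⊕_ (Euler⁻.h-second-gap K N t≤ lt) (E-second N t (ℕ.<⇒≤ t≤) (<-pred (p-second-suc N t) lt)))
      (ℤ.+-identityˡ _))

-1^n*-1^n≡1 : ∀ n → -1ℤ ^ n * -1ℤ ^ n ≡ 1ℤ
-1^n*-1^n≡1 zero    = refl
-1^n*-1^n≡1 (suc n) = trans (alg (-1ℤ ^ n)) (-1^n*-1^n≡1 n)
  where
  alg : ∀ s → -1ℤ * s * (-1ℤ * s) ≡ s * s
  alg = solve-∀

-1^[n+n]≡1 : ∀ n → -1ℤ ^ (n + n) ≡ 1ℤ
-1^[n+n]≡1 n = trans (ℤ.^-distribˡ-+-* -1ℤ n n) (-1^n*-1^n≡1 n)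

p-pos : ∀ N t → 0 < p (suc N) + t
p-pos N t = ℕ.≤-trans (s≤s z≤n) (ℕ.≤-trans (ℕ.m≤n+m (2 + (N + N + N)) (p N)) (ℕ.m≤m+n _ t))

p-second-pos : ∀ N t → 0 < p N + (suc (N + N) + t)
p-second-pos N t = ℕ.≤-trans (s≤s z≤n) (ℕ.m≤n+m (suc (N + N) + t) (p N))

module _ (K : ℕ) where
  private
    s : ℕ → ℤ
    s = -1ℤ ^_

  -- D changes sign at each step, with an additional +1 or -1 at the two kinds of pentagonal
  -- numbers. The index starts at `suc N` because n = 0, alone in its interval, precedes the
  -- correction 2q and does not fit the pattern.
  D-first : ∀ N t → t ≤ suc N + suc N → p (suc N) + t < 2 + K → D K (+ (p (suc N) + t)) ≡ s N * s t
  D-second : ∀ N t → t ≤ N → p N + (suc (N + N) + t) < 2 + K → D K (+ (p N + (suc (N + N) + t))) ≡ (s N - 1ℤ) * s t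

  D-first N zero    _  lt = begin
    D K (+ (p (suc N) + 0))
      ≡⟨ D-step K (p-first-pred N) (p-second-pos N N) ⟩
    Euler⁺.h K 0 (+ (p (suc N) + 0)) - D K (+ (p N + (suc (N + N) + N)))
      -- The preceding interval ends at offset N, which brings in the second factor `s N`.
      ≡⟨ cong₂ _-_ (trans (Euler⁺.h-first K (suc N) lt) (ℤ.^-zeroˡ (suc N))) (D-second N N ℕ.≤-refl (<-pred (p-first-pred N) lt)) ⟩
    1ℤ - (s N - 1ℤ) * s N
      ≡⟨ alg (s N) ⟩
    1ℤ ⊕ s N - s N * s N
      ≡⟨ cong (λ u → 1ℤ ⊕ s N - u) (-1^n*-1^n≡1 N) ⟩
    1ℤ ⊕ s N - 1ℤ
      ≡⟨ alg′ (s N) ⟩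
    s N * 1ℤ ∎
    where
    open ≡-Reasoning
    alg : ∀ u → 1ℤ - (u - 1ℤ) * u ≡ 1ℤ ⊕ u - u * u
    alg = solve-∀
    alg′ : ∀ u → 1ℤ ⊕ u - 1ℤ ≡ u * 1ℤ
    alg′ = solve-∀
  D-first N (suc t) t≤ lt = begin
    D K (+ (p (suc N) + suc t))
      ≡⟨ D-step K (ℕ.+-suc (p (suc N)) t) (p-pos N t) ⟩
    Euler⁺.h K 0 (+ (p (suc N) + suc t)) - D K (+ (p (suc N) + t))
      ≡⟨ cong₂ _-_ (Euler⁺.h-first-gap K (suc N) t≤ lt) (D-first N t (ℕ.<⇒≤ t≤) (<-pred (ℕ.+-suc (p (suc N)) t) lt)) ⟩
    0ℤ - s N * s t
      ≡⟨ alg (s N) (s t) ⟩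
    s N * s (suc t) ∎
    where
    open ≡-Reasoning
    alg : ∀ u v → 0ℤ - u * v ≡ u * (-1ℤ * v)
    alg = solve-∀

  D-second zero    zero    _  lt = D₁ K
  D-second (suc N) zero    _  lt = begin
    D K (+ (p (suc N) + (suc (suc N + suc N) + 0)))
      ≡⟨ D-step K (p-second-pred (suc N)) (p-pos N (suc N + suc N)) ⟩
    Euler⁺.h K 0 (+ (p (suc N) + (suc (suc N + suc N) + 0))) - D K (+ (p (suc N) + (suc N + suc N)))
      ≡⟨ cong₂ _-_ (trans (Euler⁺.h-second K (suc N) lt) (cong -_ (ℤ.^-zeroˡ (suc N)))) (D-first N (suc N + suc N) ℕ.≤-refl (<-pred (p-second-pred (suc N)) lt)) ⟩
    -1ℤ - s N * s (suc N + suc N)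
      -- The preceding interval ends at an even offset, so the alternation is back at its initial
      -- sign.
      ≡⟨ cong (λ u → -1ℤ - s N * u) (-1^[n+n]≡1 (suc N)) ⟩
    -1ℤ - s N * 1ℤ
      ≡⟨ alg (s N) ⟩
    (s (suc N) - 1ℤ) * 1ℤ ∎
    where
    open ≡-Reasoning
    alg : ∀ u → -1ℤ - u * 1ℤ ≡ (-1ℤ * u - 1ℤ) * 1ℤ
    alg = solve-∀
  D-second N (suc t) t≤ lt = begin
    D K (+ (p N + (suc (N + N) + suc t)))
      ≡⟨ D-step K (p-second-suc N t) (p-second-pos N t) ⟩
    Euler⁺.h K 0 (+ (p N + (suc (N + N) + suc t))) - D K (+ (p N + (suc (N + N) + t)))
      ≡⟨ cong₂ _-_ (Euler⁺.h-second-gap K N t≤ lt) (D-second N t (ℕ.<⇒≤ t≤) (<-pred (p-second-suc N t) lt)) ⟩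
    0ℤ - (s N - 1ℤ) * s t
      ≡⟨ alg (s N - 1ℤ) (s t) ⟩
    (s N - 1ℤ) * s (suc t) ∎
    where
    open ≡-Reasoning
    alg : ∀ u v → 0ℤ - u * v ≡ u * (-1ℤ * v)
    alg = solve-∀

-- Signs and parity of the crank.

parity : ∀ n → (2 ∣ n × -1ℤ ^ n ≡ 1ℤ) ⊎ (¬ 2 ∣ n × -1ℤ ^ n ≡ -1ℤ)
parity zero          = inj₁ (2 ∣0 , refl)
parity (suc zero)    = inj₂ ((λ 2∣1 → contradiction (∣1⇒≡1 2∣1) λ ()) , refl)
parity (suc (suc n)) with parity n
... | inj₁ (2∣n , eq) = inj₁ (∣m∣n⇒∣m+n ∣-refl 2∣n , cong (λ u → -1ℤ * (-1ℤ * u)) eq)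
... | inj₂ (2∤n , eq) = inj₂ ((λ d → 2∤n (∣m+n∣m⇒∣n d ∣-refl)) , cong (λ u → -1ℤ * (-1ℤ * u)) eq)

sgn : ℤ → ℤ
sgn i = if does (even? i) then 1ℤ else -1ℤ

sgn-even : ∀ {i} → Even i → sgn i ≡ 1ℤ
sgn-even {i} e = cong (if_then 1ℤ else -1ℤ) (dec-true (even? i) e)

sgn-odd : ∀ {i} → Odd i → sgn i ≡ -1ℤ
sgn-odd {i} o = cong (if_then 1ℤ else -1ℤ) (dec-false (even? i) o)

sgn-pos : ∀ n → sgn (+ n) ≡ -1ℤ ^ n
sgn-pos n with parity n
... | inj₁ (2∣n , eq) = trans (sgn-even {+ n} 2∣n) (sym eq)
... | inj₂ (2∤n , eq) = trans (sgn-odd {+ n} 2∤n) (sym eq)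

-- The crank of the partition 1 is -1, so the lengths for which n - 2 is negative are computed
-- separately.
sgn-minus-2 : ∀ n → sgn (+ n - + 2) ≡ -1ℤ ^ n
sgn-minus-2 zero          = refl
sgn-minus-2 (suc zero)    = refl
sgn-minus-2 (suc (suc n)) = trans (sgn-pos n) (alg (-1ℤ ^ n))
  where
  alg : ∀ u → u ≡ -1ℤ * (-1ℤ * u)
  alg = solve-∀

-- From counting partitions to coefficients of D and E.

-- The coefficient of qⁿ in Σ w(ps) q^(sum ps).
S : (List ℕ → ℤ) → List (List ℕ) → ℤ → ℤ
S w []         n = 0ℤ
S w (ps ∷ pss) n = w ps * δ (n - + sum ps) ⊕ S w pss n

S-++ : ∀ w pss qss n → S w (pss ++ qss) n ≡ S w pss n ⊕ S w qss n
S-++ w []         qss n = sym (ℤ.+-identityˡ _)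
S-++ w (ps ∷ pss) qss n =
  trans (cong (w ps * δ (n - + sum ps) ⊕_) (S-++ w pss qss n)) (sym (ℤ.+-assoc (w ps * δ (n - + sum ps)) (S w pss n) (S w qss n)))

S-map-∷ : ∀ w k pss n → S w (map (k ∷_) pss) n ≡ S (w ∘ (k ∷_)) pss (n - + k)
S-map-∷ w k []         n = refl
S-map-∷ w k (ps ∷ pss) n =
  cong₂ (λ i u → w (k ∷ ps) * δ i ⊕ u) (alg n (+ k) (+ sum ps)) (S-map-∷ w k pss n)
  where
  alg : ∀ n k s → n - (k ⊕ s) ≡ n - k - s
  alg = solve-∀

S-+ : ∀ w w′ pss n → S (λ ps → w ps ⊕ w′ ps) pss n ≡ S w pss n ⊕ S w′ pss n
S-+ w w′ []         n = refl
S-+ w w′ (ps ∷ pss) n =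
  trans (cong ((w ps ⊕ w′ ps) * δ (n - + sum ps) ⊕_) (S-+ w w′ pss n))
    (alg (w ps) (w′ ps) (δ (n - + sum ps)) (S w pss n) (S w′ pss n))
  where
  alg : ∀ a b d u v → (a ⊕ b) * d ⊕ (u ⊕ v) ≡ a * d ⊕ u ⊕ (b * d ⊕ v)
  alg = solve-∀

S-scale : ∀ c w pss n → S (λ ps → c * w ps) pss n ≡ c * S w pss n
S-scale c w []         n = sym (ℤ.*-zeroʳ c)
S-scale c w (ps ∷ pss) n =
  trans (cong (c * w ps * δ (n - + sum ps) ⊕_) (S-scale c w pss n)) (alg c (w ps) (δ (n - + sum ps)) (S w pss n))
  where
  alg : ∀ c b d v → c * b * d ⊕ c * v ≡ c * (b * d ⊕ v)
  alg = solve-∀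

S-cong : ∀ {w w′ pss} n → All (λ ps → w ps ≡ w′ ps) pss → S w pss n ≡ S w′ pss n
S-cong n []         = refl
S-cong n (eq ∷ eqs) = cong₂ (λ a b → a * δ _ ⊕ b) eq (S-cong n eqs)

δ-minus-≢ : ∀ {m n} → ¬ (m ≡ n) → δ (+ n - + m) ≡ 0ℤ
δ-minus-≢ {m} {n} m≢n with + n - + m in eq
... | + zero      = contradiction (ℤ.+-injective (sym (ℤ.i-j≡0⇒i≡j (+ n) (+ m) eq))) m≢n
... | + suc _     = refl
... | -[1+ _ ]    = refl

evenMinusOdd : List (List ℕ) → ℤ
evenMinusOdd pss = + length (filter (even? ∘ crank) pss) - + length (filter (odd? ∘ crank) pss)

evenMinusOdd-∷ : ∀ ps pss → evenMinusOdd (ps ∷ pss) ≡ sgn (crank ps) ⊕ evenMinusOdd pss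
evenMinusOdd-∷ ps pss = by-parity (even? (crank ps))
  where
  evens = length (filter (even? ∘ crank) pss)
  odds  = length (filter (odd? ∘ crank) pss)
  alg₁ : ∀ a b → 1ℤ ⊕ a - b ≡ 1ℤ ⊕ (a - b)
  alg₁ = solve-∀
  alg₂ : ∀ a b → a - (1ℤ ⊕ b) ≡ -1ℤ ⊕ (a - b)
  alg₂ = solve-∀
  by-parity : Dec (Even (crank ps)) → evenMinusOdd (ps ∷ pss) ≡ sgn (crank ps) ⊕ evenMinusOdd pss
  by-parity (yes e) = trans
    (cong₂ (λ us vs → + length us - + length vs)
      (filter-accept (even? ∘ crank) {ps} {pss} e) (filter-reject (odd? ∘ crank) {ps} {pss} (λ o → o e)))
    (trans (alg₁ (+ evens) (+ odds)) (cong (_⊕ evenMinusOdd pss) (sym (sgn-even {crank ps} e))))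
  by-parity (no o) = trans
    (cong₂ (λ us vs → + length us - + length vs)
      (filter-reject (even? ∘ crank) {ps} {pss} o) (filter-accept (odd? ∘ crank) {ps} {pss} o))
    (trans (alg₂ (+ evens) (+ odds)) (cong (_⊕ evenMinusOdd pss) (sym (sgn-odd {crank ps} o))))

-- Reading the condition on the sum as extraction of a coefficient removes the filter, so that the
-- recursion of `distinctPartsUpTo` can be followed.
evenMinusOdd-filter-sum : ∀ n pss →
  evenMinusOdd (filter (λ ps → sum ps ℕ.≟ n) pss) ≡ S (sgn ∘ crank) pss (+ n)
evenMinusOdd-filter-sum n []         = refl
evenMinusOdd-filter-sum n (ps ∷ pss) = by-sum (sum ps ℕ.≟ n)
  where
  open ≡-Reasoning
  s = sgn (crank ps)
  rest = S (sgn ∘ crank) pss (+ n)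
  sum≟n : ∀ qs → Dec (sum qs ≡ n)
  sum≟n qs = sum qs ℕ.≟ n
  by-sum : Dec (sum ps ≡ n) → evenMinusOdd (filter sum≟n (ps ∷ pss)) ≡ s * δ (+ n - + sum ps) ⊕ rest
  by-sum (no s≢n) = begin
    evenMinusOdd (filter sum≟n (ps ∷ pss))   ≡⟨ cong evenMinusOdd (filter-reject sum≟n {ps} {pss} s≢n) ⟩
    evenMinusOdd (filter sum≟n pss)          ≡⟨ evenMinusOdd-filter-sum n pss ⟩
    rest                                     ≡⟨ ℤ.+-identityˡ rest ⟨
    0ℤ ⊕ rest                                ≡⟨ cong (_⊕ rest) (ℤ.*-zeroʳ s) ⟨
    s * 0ℤ ⊕ rest                            ≡⟨ cong (λ u → s * u ⊕ rest) (δ-minus-≢ s≢n) ⟨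
    s * δ (+ n - + sum ps) ⊕ rest            ∎
  by-sum (yes s≡n) = begin
    evenMinusOdd (filter sum≟n (ps ∷ pss))   ≡⟨ cong evenMinusOdd (filter-accept sum≟n {ps} {pss} s≡n) ⟩
    evenMinusOdd (ps ∷ filter sum≟n pss)     ≡⟨ evenMinusOdd-∷ ps (filter sum≟n pss) ⟩
    s ⊕ evenMinusOdd (filter sum≟n pss)      ≡⟨ cong₂ _⊕_ (sym (ℤ.*-identityʳ s)) (evenMinusOdd-filter-sum n pss) ⟩
    s * 1ℤ ⊕ rest                            ≡⟨ cong (λ i → s * δ i ⊕ rest) (ℤ.i≡j⇒i-j≡0 {+ n} (cong +_ (sym s≡n))) ⟨
    s * δ (+ n - + sum ps) ⊕ rest            ∎

-- The sign of the crank split by whether 1 is a part, with (-1)^length in place of (-1)^(length -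
-- 2). `onlyWithout1` is what remains of `maxWithout1` once the largest part is removed.
onlyWith1 onlyWithout1 maxWithout1 : List ℕ → ℤ
onlyWith1    ps = if does (1 ∈? ps) then -1ℤ ^ length ps else 0ℤ
onlyWithout1 ps = if does (1 ∈? ps) then 0ℤ else 1ℤ
maxWithout1  ps = if does (1 ∈? ps) then 0ℤ else -1ℤ ^ max 0 ps

sgn-crank : ∀ ps → sgn (crank ps) ≡ maxWithout1 ps ⊕ onlyWith1 ps
sgn-crank ps with does (1 ∈? ps)
... | true  = trans (sgn-minus-2 (length ps)) (sym (ℤ.+-identityˡ _))
... | false = trans (sgn-pos (max 0 ps)) (sym (ℤ.+-identityʳ _))

parts≤ : ∀ k → All (All (_≤ k)) (distinctPartsUpTo k)
parts≤ zero    = [] ∷ []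
parts≤ (suc k) = All.++⁺ weaken (All.map⁺ (All.map (ℕ.≤-refl ∷_) weaken))
  where
  weaken : All (All (_≤ suc k)) (distinctPartsUpTo k)
  weaken = All.map (All.map ℕ.m≤n⇒m≤1+n) (parts≤ k)

max-∷ : ∀ {k ps} → All (_≤ k) ps → max 0 (suc k ∷ ps) ≡ suc k
max-∷ ps≤k = f[argmax]≈f[v]⁺ {f = id} (here refl) (ℕ.≤-refl ∷ All.map ℕ.m≤n⇒m≤1+n ps≤k) z≤n

-- A part ≥ 2 does not affect the test for 1, by computation, and lengthens the list by one.
onlyWith1-∷ : ∀ k ps → onlyWith1 (2 + k ∷ ps) ≡ -1ℤ * onlyWith1 ps
onlyWith1-∷ k ps with does (1 ∈? ps)
... | true  = refl
... | false = refl

-- The new part is the maximum, so the sign no longer depends on the other parts.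
maxWithout1-∷ : ∀ {k ps} → All (_≤ suc k) ps → maxWithout1 (2 + k ∷ ps) ≡ -1ℤ ^ (2 + k) * onlyWithout1 ps
maxWithout1-∷ {k} {ps} ps≤ with does (1 ∈? ps)
... | true  = sym (ℤ.*-zeroʳ (-1ℤ ^ (2 + k)))
... | false = trans (cong (-1ℤ ^_) (max-∷ ps≤)) (sym (ℤ.*-identityʳ _))

S-distinctPartsUpTo : ∀ w k n → S w (distinctPartsUpTo (suc k)) n ≡
  S w (distinctPartsUpTo k) n ⊕ S (w ∘ (suc k ∷_)) (distinctPartsUpTo k) (n - + suc k)
S-distinctPartsUpTo w k n = trans (S-++ w (distinctPartsUpTo k) _ n)
  (cong (S w (distinctPartsUpTo k) n ⊕_) (S-map-∷ w (suc k) (distinctPartsUpTo k) n))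

S-onlyWithout1 : ∀ k n → S onlyWithout1 (distinctPartsUpTo (suc k)) n ≡ Euler⁺.W 2 k n
-- The lists are `[]` and 1 alone; the latter has weight 0.
S-onlyWithout1 zero    n = trans (cong (λ i → 1ℤ * δ i ⊕ 0ℤ) (ℤ.+-identityʳ n)) (alg (δ n))
  where
  alg : ∀ a → 1ℤ * a ⊕ 0ℤ ≡ a
  alg = solve-∀
S-onlyWithout1 (suc k) n = trans (S-distinctPartsUpTo onlyWithout1 (suc k) n)
  (cong₂ _⊕_ (S-onlyWithout1 k n)
    (trans (S-onlyWithout1 k (n - + (2 + k)))
      (trans (cong (λ i → Euler⁺.W 2 k (n - + i)) (ℕ.+-comm 2 k)) (sym (ℤ.*-identityˡ _)))))

S-maxWithout1 : ∀ k n → S maxWithout1 (distinctPartsUpTo (suc k)) n ≡ D k n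
S-maxWithout1 zero    n = trans (cong (λ i → 1ℤ * δ i ⊕ 0ℤ) (ℤ.+-identityʳ n)) (alg (δ n))
  where
  alg : ∀ a → 1ℤ * a ⊕ 0ℤ ≡ a
  alg = solve-∀
S-maxWithout1 (suc k) n = trans (S-distinctPartsUpTo maxWithout1 (suc k) n)
  (cong₂ _⊕_ (S-maxWithout1 k n) (begin
    S (maxWithout1 ∘ (2 + k ∷_)) pss m              ≡⟨ S-cong m (All.map maxWithout1-∷ (parts≤ (suc k))) ⟩
    S (λ ps → -1ℤ ^ (2 + k) * onlyWithout1 ps) pss m ≡⟨ S-scale (-1ℤ ^ (2 + k)) onlyWithout1 pss m ⟩
    -1ℤ ^ (2 + k) * S onlyWithout1 pss m            ≡⟨ cong (-1ℤ ^ (2 + k) *_) (S-onlyWithout1 k m) ⟩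
    -1ℤ ^ (2 + k) * Euler⁺.W 2 k m                      ∎))
  where
  open ≡-Reasoning
  pss = distinctPartsUpTo (suc k)
  m = n - + (2 + k)

-- Removing the part 1 costs a factor q and a sign.
S-onlyWith1 : ∀ k n → S onlyWith1 (distinctPartsUpTo (suc k)) n ≡ - E k (n - 1ℤ)
S-onlyWith1 zero    n = alg (δ (n - 0ℤ)) (δ (n - 1ℤ))
  where
  alg : ∀ a b → 0ℤ * a ⊕ (-1ℤ * b ⊕ 0ℤ) ≡ - b
  alg = solve-∀
S-onlyWith1 (suc k) n = begin
  S onlyWith1 (distinctPartsUpTo (2 + k)) n
    ≡⟨ S-distinctPartsUpTo onlyWith1 (suc k) n ⟩
  S onlyWith1 pss n ⊕ S (onlyWith1 ∘ (2 + k ∷_)) pss m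
    ≡⟨ cong (S onlyWith1 pss n ⊕_) (trans (S-cong m (All.universal (onlyWith1-∷ k) pss)) (S-scale -1ℤ onlyWith1 pss m)) ⟩
  S onlyWith1 pss n ⊕ -1ℤ * S onlyWith1 pss m
    ≡⟨ cong₂ (λ a b → a ⊕ -1ℤ * b) (S-onlyWith1 k n) (S-onlyWith1 k m) ⟩
  - E k (n - 1ℤ) ⊕ -1ℤ * - E k (m - 1ℤ)
    ≡⟨ cong (λ i → - E k (n - 1ℤ) ⊕ -1ℤ * - E k i) (i₁ n (+ k)) ⟩
  - E k (n - 1ℤ) ⊕ -1ℤ * - E k (n - 1ℤ - + (k + 2))
    ≡⟨ alg (E k (n - 1ℤ)) (E k (n - 1ℤ - + (k + 2))) ⟩
  - E (suc k) (n - 1ℤ) ∎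
  where
  open ≡-Reasoning
  pss = distinctPartsUpTo (suc k)
  m = n - + (2 + k)
  i₁ : ∀ n k → n - (+ 2 ⊕ k) - 1ℤ ≡ n - 1ℤ - (k ⊕ + 2)
  i₁ = solve-∀
  alg : ∀ a b → - a ⊕ -1ℤ * - b ≡ - (a ⊕ -1ℤ * b)
  alg = solve-∀

-- For n = K + 1 the lists in `distinctPartsUpTo n` have parts up to K + 1, the range covered by
-- `D K` and `E K`.
Mₑ-Mₒ : ∀ K → + Mₑ (suc K) - + Mₒ (suc K) ≡ D K (+ suc K) - E K (+ K)
Mₑ-Mₒ K = begin
  + Mₑ n - + Mₒ n
    ≡⟨ evenMinusOdd-filter-sum n pss ⟩
  S (sgn ∘ crank) pss (+ n)
    ≡⟨ S-cong (+ n) (All.universal sgn-crank pss) ⟩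
  S (λ ps → maxWithout1 ps ⊕ onlyWith1 ps) pss (+ n)
    ≡⟨ S-+ maxWithout1 onlyWith1 pss (+ n) ⟩
  S maxWithout1 pss (+ n) ⊕ S onlyWith1 pss (+ n)
    ≡⟨ cong₂ _⊕_ (S-maxWithout1 K (+ n)) (S-onlyWith1 K (+ n)) ⟩
  D K (+ n) - E K (+ K) ∎
  where
  open ≡-Reasoning
  n = suc K
  pss = distinctPartsUpTo n

-- Locating n among the pentagonal numbers.

p-pentagonal : ∀ N → + 2 * + p N ≡ + N * (+ 3 * + N ⊕ + 1)
p-pentagonal zero    = refl
p-pentagonal (suc N) = trans (alg (+ p N) (+ N)) (trans (cong (_⊕ (+ 4 ⊕ + 6 * + N)) (p-pentagonal N)) (alg′ (+ N)))
  where
  alg : ∀ q N → + 2 * (q ⊕ (+ 2 ⊕ (N ⊕ N ⊕ N))) ≡ + 2 * q ⊕ (+ 4 ⊕ + 6 * N)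
  alg = solve-∀
  alg′ : ∀ N → N * (+ 3 * N ⊕ + 1) ⊕ (+ 4 ⊕ + 6 * N) ≡ (+ 1 ⊕ N) * (+ 3 * (+ 1 ⊕ N) ⊕ + 1)
  alg′ = solve-∀

p-second-pentagonal : ∀ N → + 2 * + (p N + suc (N + N)) ≡ -[1+ N ] * (+ 3 * -[1+ N ] ⊕ + 1)
p-second-pentagonal N = trans (alg (+ p N) (+ N)) (trans (cong (_⊕ (+ 2 ⊕ + 4 * + N)) (p-pentagonal N)) (alg′ (+ N)))
  where
  alg : ∀ q N → + 2 * (q ⊕ (+ 1 ⊕ (N ⊕ N))) ≡ + 2 * q ⊕ (+ 2 ⊕ + 4 * N)
  alg = solve-∀
  alg′ : ∀ N → N * (+ 3 * N ⊕ + 1) ⊕ (+ 2 ⊕ + 4 * N) ≡ (- (+ 1 ⊕ N)) * (+ 3 * (- (+ 1 ⊕ N)) ⊕ + 1)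
  alg′ = solve-∀

p-mono-≤ : ∀ {M N} → M ≤ N → p M ≤ p N
p-mono-≤ {N = zero}  z≤n = ℕ.≤-refl
p-mono-≤ {N = suc N} M≤1+N with ℕ.m≤n⇒m<n∨m≡n M≤1+N
... | inj₁ (s≤s M≤N) = ℕ.≤-trans (p-mono-≤ M≤N) (ℕ.m≤m+n (p N) _)
... | inj₂ refl      = ℕ.≤-refl

p-cancel-< : ∀ {M N} → p M < p N → M < N
p-cancel-< pM<pN = ℕ.≰⇒> (λ N≤M → ℕ.<⇒≱ pM<pN (p-mono-≤ N≤M))

p-block-unique : ∀ {M N q} → p M ≤ q → q < p (suc M) → p N ≤ q → q < p (suc N) → M ≡ N
p-block-unique M≤ <M N≤ <N = ℕ.≤-antisym
  (ℕ.≤-pred (p-cancel-< (ℕ.≤-<-trans M≤ <N)))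
  (ℕ.≤-pred (p-cancel-< (ℕ.≤-<-trans N≤ <M)))

p+first<p : ∀ N {t} → t ≤ N + N → p N + t < p (suc N)
p+first<p N t≤ = ℕ.+-monoʳ-< (p N) (s≤s (ℕ.m≤n⇒m≤1+n (ℕ.≤-trans t≤ (ℕ.m≤m+n (N + N) N))))

p+second<p : ∀ N {t} → t ≤ N → p N + (suc (N + N) + t) < p (suc N)
p+second<p N t≤ = ℕ.+-monoʳ-< (p N) (s≤s (s≤s (ℕ.+-monoʳ-≤ (N + N) t≤)))

-- A root M ≥ 0 gives p M and a root -(M+1) gives p M + 2M + 1. Both lie in block M, and blocks are
-- disjoint.
pentagonals-in-block : ∀ N {q} (q∈𝒫 : q ∈ 𝒫) → p N ≤ q → q < p (suc N) →
  (q ≡ p N × R q q∈𝒫 ≡ + N) ⊎ (q ≡ p N + suc (N + N) × R q q∈𝒫 ≡ -[1+ N ])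
pentagonals-in-block N {q} (+ M , eq) N≤q q<N = inj₁ (trans q≡ (cong p M≡N) , cong +_ M≡N)
  where
  q≡ : q ≡ p M
  q≡ = ℤ.+-injective (ℤ.*-cancelˡ-≡ (+ 2) (+ q) (+ p M) (trans eq (sym (p-pentagonal M))))
  M≡N : M ≡ N
  M≡N = p-block-unique (ℕ.≤-reflexive (sym q≡))
    (subst (_< p (suc M)) (trans (ℕ.+-identityʳ (p M)) (sym q≡)) (p+first<p M z≤n)) N≤q q<N
pentagonals-in-block N {q} (-[1+ M ] , eq) N≤q q<N =
  inj₂ (trans q≡ (cong (λ i → p i + suc (i + i)) M≡N) , cong -[1+_] M≡N)
  where
  q≡ : q ≡ p M + suc (M + M)
  q≡ = ℤ.+-injective (ℤ.*-cancelˡ-≡ (+ 2) (+ q) (+ (p M + suc (M + M))) (trans eq (sym (p-second-pentagonal M))))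
  M≡N : M ≡ N
  M≡N = p-block-unique (ℕ.≤-trans (ℕ.m≤m+n (p M) _) (ℕ.≤-reflexive (sym q≡)))
    (subst (_< p (suc M)) (trans (cong (λ i → p M + i) (ℕ.+-identityʳ (suc (M + M)))) (sym q≡)) (p+second<p M z≤n)) N≤q q<N

-- As p N ≤ n, the floor stays in the block of n; the other pentagonal number of the block exceeds
-- n.
⌊⌋ₚ-first : ∀ N {t} → t ≤ N + N → ⌊ p N + t ⌋ₚ ≡ p N × R⌊ p N + t ⌋ₚ ≡ + N
⌊⌋ₚ-first N {t} t≤ with pentagonals-in-block N (⌊⌋ₚ∈𝒫 (p N + t))
    (⌊⌋ₚ-greatest (p N + t) (+ N , p-pentagonal N) (ℕ.m≤m+n (p N) t))
    (ℕ.≤-<-trans (⌊⌋ₚ≤ (p N + t)) (p+first<p N t≤))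
... | inj₁ eqs       = eqs
... | inj₂ (eq , _)  = contradiction (subst (_≤ p N + t) eq (⌊⌋ₚ≤ (p N + t)))
  (ℕ.<⇒≱ (ℕ.+-monoʳ-< (p N) (s≤s t≤)))

⌊⌋ₚ-second : ∀ N {t} → t ≤ N →
  let n = p N + (suc (N + N) + t) in ⌊ n ⌋ₚ ≡ p N + suc (N + N) × R⌊ n ⌋ₚ ≡ -[1+ N ]
⌊⌋ₚ-second N {t} t≤ = exclude-first
  (pentagonals-in-block N (⌊⌋ₚ∈𝒫 n) (ℕ.≤-trans (ℕ.m≤m+n (p N) _) a≤⌊n⌋) (ℕ.≤-<-trans (⌊⌋ₚ≤ n) (p+second<p N t≤)))
  where
  n = p N + (suc (N + N) + t)
  a = p N + suc (N + N)
  a≤⌊n⌋ : a ≤ ⌊ n ⌋ₚ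
  a≤⌊n⌋ = ⌊⌋ₚ-greatest n (-[1+ N ] , p-second-pentagonal N) (ℕ.+-monoʳ-≤ (p N) (ℕ.m≤m+n (suc (N + N)) t))
  exclude-first : ∀ {r} → (⌊ n ⌋ₚ ≡ p N × r ≡ + N) ⊎ (⌊ n ⌋ₚ ≡ a × r ≡ -[1+ N ]) → ⌊ n ⌋ₚ ≡ a × r ≡ -[1+ N ]
  exclude-first (inj₁ (eq , _)) = contradiction (subst (a ≤_) eq a≤⌊n⌋) (ℕ.<⇒≱ (ℕ.m<m+n (p N) (s≤s z≤n)))
  exclude-first (inj₂ eqs)      = eqs

∈𝒫⇒⌊⌋ₚ≡ : ∀ {n} → n ∈ 𝒫 → ⌊ n ⌋ₚ ≡ n
∈𝒫⇒⌊⌋ₚ≡ {n} n∈𝒫 = ℕ.≤-antisym (⌊⌋ₚ≤ n) (⌊⌋ₚ-greatest n n∈𝒫 ℕ.≤-refl)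

-- The parameter `t` is the distance from the last pentagonal number; the bounds on it are the
-- lengths of the two intervals of a block.
data Position : ℕ → Set where
  first  : ∀ N t → t ≤ N + N → Position (p N + t)
  second : ∀ N t → t ≤ N → Position (p N + (suc (N + N) + t))

position : ∀ n → Position n
position zero    = first 0 0 z≤n
position (suc n) with position n
... | first N t t≤ with ℕ.m≤n⇒m<n∨m≡n t≤
...   | inj₁ t<   = subst Position (ℕ.+-suc (p N) t) (first N (suc t) t<)
...   | inj₂ refl = subst Position (p-second-pred N) (second N 0 z≤n)
position (suc n) | second N t t≤ with ℕ.m≤n⇒m<n∨m≡n t≤
...   | inj₁ t<   = subst Position (p-second-suc N t) (second N (suc t) t<)
...   | inj₂ refl = subst Position (p-first-pred N) (first (suc N) 0 z≤n)

-- The difference of the counts at each position.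

-1^-%2 : ∀ n → -1ℤ ^ n ≡ -1ℤ ^ (n % 2)
-1^-%2 zero          = refl
-1^-%2 (suc zero)    = refl
-1^-%2 (suc (suc n)) = trans (alg (-1ℤ ^ n)) (-1^-%2 n)
  where
  alg : ∀ u → -1ℤ * (-1ℤ * u) ≡ u
  alg = solve-∀

[m+n]%2≡m%2⇒-1^n≡1 : ∀ m n → (m + n) % 2 ≡ m % 2 → -1ℤ ^ n ≡ 1ℤ
[m+n]%2≡m%2⇒-1^n≡1 m n eq = begin
  t                                    ≡⟨ ℤ.*-identityˡ t ⟨
  1ℤ * t                               ≡⟨ cong (_* t) (-1^n*-1^n≡1 m) ⟨
  s * s * t                            ≡⟨ ℤ.*-assoc s s t ⟩
  s * (s * t)                          ≡⟨ cong (s *_) (ℤ.^-distribˡ-+-* -1ℤ m n) ⟨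
  s * -1ℤ ^ (m + n)                    ≡⟨ cong (s *_) (trans (-1^-%2 (m + n)) (trans (cong (-1ℤ ^_) eq) (sym (-1^-%2 m)))) ⟩
  s * s                                ≡⟨ -1^n*-1^n≡1 m ⟩
  1ℤ                                   ∎
  where
  open ≡-Reasoning
  s = -1ℤ ^ m
  t = -1ℤ ^ n

2∣n⇒[m+n]%2≡m%2 : ∀ m {n} → 2 ∣ n → (m + n) % 2 ≡ m % 2
2∣n⇒[m+n]%2≡m%2 m (divides k refl) = [m+kn]%n≡m%n m k 2

2∣n⇒-1^n≡1 : ∀ {n} → 2 ∣ n → -1ℤ ^ n ≡ 1ℤ
2∣n⇒-1^n≡1 {n} 2∣n with parity n
... | inj₁ (_ , eq)  = eq
... | inj₂ (2∤n , _) = contradiction 2∣n 2∤n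

2∤n⇒-1^n≡-1 : ∀ {n} → ¬ 2 ∣ n → -1ℤ ^ n ≡ -1ℤ
2∤n⇒-1^n≡-1 {n} 2∤n with parity n
... | inj₁ (2∣n , _) = contradiction 2∣n 2∤n
... | inj₂ (_ , eq)  = eq

M : ℕ → ℤ
M n = + Mₑ n - + Mₒ n

-- The number n - 1 may lie in the preceding interval. `E-difference` trades E at n - 1 for E and
-- `h` at n, so everything is evaluated at one position.
M-by-position : ∀ {n d e g} → 0 < n →
  (∀ K → n < 2 + K → D K (+ n) ≡ d) → (∀ K → n < 2 + K → E K (+ n) ≡ e) → (∀ K → n < 2 + K → Euler⁻.h K 0 (+ n) ≡ g) →
  M n ≡ d - e ⊕ g
M-by-position {suc K} {d} {e} {g} _ D≡ E≡ h≡ = begin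
  M (suc K)
    ≡⟨ Mₑ-Mₒ K ⟩
  D K (+ suc K) - E K (+ K)
    ≡⟨ alg (D K (+ suc K)) (E K (+ suc K)) (E K (+ K)) ⟩
  D K (+ suc K) - E K (+ suc K) ⊕ (E K (+ suc K) - E K (+ K))
    ≡⟨ cong (D K (+ suc K) - E K (+ suc K) ⊕_) (E-difference K (+ suc K)) ⟩
  D K (+ suc K) - E K (+ suc K) ⊕ Euler⁻.h K 0 (+ suc K)
    ≡⟨ cong₂ _⊕_ (cong₂ _-_ (D≡ K ℕ.≤-refl) (E≡ K ℕ.≤-refl)) (h≡ K ℕ.≤-refl) ⟩
  d - e ⊕ g ∎
  where
  open ≡-Reasoning
  alg : ∀ d e e′ → d - e′ ≡ d - e ⊕ (e - e′)
  alg = solve-∀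

M-first : ∀ N → M (p (suc N) + 0) ≡ - (-1ℤ ^ suc N)
M-first N = trans
  (M-by-position (p-pos N 0) (λ K → D-first K N 0 z≤n) (λ K → E-first K (suc N) 0 z≤n) (λ K → Euler⁻.h-first K (suc N)))
  (alg (-1ℤ ^ N))
  where
  alg : ∀ s → s * 1ℤ - -1ℤ * s ⊕ -1ℤ * s ≡ - (-1ℤ * s)
  alg = solve-∀

-- D alternates while E is constant, so they cancel at odd offsets and reinforce each other at even
-- ones.
M-first-gap : ∀ N t → suc t ≤ suc N + suc N → M (p (suc N) + suc t) ≡ - (-1ℤ ^ suc N) * (-1ℤ ^ suc t ⊕ 1ℤ)
M-first-gap N t t< = trans
  (M-by-position (p-pos N (suc t)) (λ K → D-first K N (suc t) t<) (λ K → E-first K (suc N) (suc t) t<) (λ K → Euler⁻.h-first-gap K (suc N) t<))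
  (alg (-1ℤ ^ N) (-1ℤ ^ suc t))
  where
  alg : ∀ s u → s * u - -1ℤ * s ⊕ 0ℤ ≡ - (-1ℤ * s) * (u ⊕ 1ℤ)
  alg = solve-∀

M-second : ∀ N → M (p N + (suc (N + N) + 0)) ≡ -1ℤ
M-second N = trans
  (M-by-position (p-second-pos N 0) (λ K → D-second K N 0 z≤n) (λ K → E-second K N 0 z≤n) (λ K → Euler⁻.h-second K N))
  (alg (-1ℤ ^ N))
  where
  alg : ∀ s → (s - 1ℤ) * 1ℤ - 0ℤ ⊕ - s ≡ -1ℤ
  alg = solve-∀

-- Here E vanishes and only D is left, itself zero unless N is odd, that is, unless R = -(N+1) is
-- even.
M-second-gap : ∀ N t → suc t ≤ N → M (p N + (suc (N + N) + suc t)) ≡ - (-1ℤ ^ suc N ⊕ 1ℤ) * -1ℤ ^ suc t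
M-second-gap N t t< = trans
  (M-by-position (p-second-pos N (suc t)) (λ K → D-second K N (suc t) t<) (λ K → E-second K N (suc t) t<) (λ K → Euler⁻.h-second-gap K N t<))
  (alg (-1ℤ ^ N) (-1ℤ ^ suc t))
  where
  alg : ∀ s u → (s - 1ℤ) * u - 0ℤ ⊕ 0ℤ ≡ - (-1ℤ * s ⊕ 1ℤ) * u
  alg = solve-∀

-- The six cases of the formula.

Formula : ℕ → Set
Formula n =
  (Case₁ n → M n ≡ + 1) ×
  (Case₂ n → M n ≡ - + 1) ×
  (Case₃ n → M n ≡ + 2) ×
  (Case₄ n → M n ≡ - + 2) ×
  (Case₅ n → M n ≡ - + 2 * (- + 1) ^ (n ∸ ⌊ n ⌋ₚ)) ×
  (¬ Case₁ n × ¬ Case₂ n × ¬ Case₃ n × ¬ Case₄ n × ¬ Case₅ n → M n ≡ + 0)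

formula-𝒫 : ∀ n (n∈𝒫 : n ∈ 𝒫) → let m = R n n∈𝒫 in
  (Odd m × Positive m → M n ≡ 1ℤ) → (¬ (Odd m × Positive m) → M n ≡ -1ℤ) → Formula n
formula-𝒫 n n∈𝒫 oddPos notOddPos =
  (λ (q , op) → oddPos (subst OddPos (R-unique n q n∈𝒫) op)) ,
  (λ (q , ¬op) → notOddPos (λ op → ¬op (subst OddPos (R-unique n n∈𝒫 q) op))) ,
  (λ (n∉𝒫 , _) → contradiction n∈𝒫 n∉𝒫) ,
  (λ (n∉𝒫 , _) → contradiction n∈𝒫 n∉𝒫) ,
  (λ (n∉𝒫 , _) → contradiction n∈𝒫 n∉𝒫) ,
  -- For pentagonal n, the failure of `Case₁` yields `Case₂`.
  (λ (¬case₁ , ¬case₂ , _) → contradiction (n∈𝒫 , (λ op → ¬case₁ (n∈𝒫 , op))) ¬case₂)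
  where
  OddPos : ℤ → Set
  OddPos i = Odd i × Positive i

formula-first : ∀ N → Formula (p (suc N) + 0)
formula-first N = formula-𝒫 (p (suc N) + 0) n∈𝒫
  (λ (2∤m , _) → trans (M-first N) (cong -_ (2∤n⇒-1^n≡-1 2∤m)))
  (λ ¬op → trans (M-first N) (by-parity (parity (suc N)) ¬op))
  where
  n∈𝒫 : p (suc N) + 0 ∈ 𝒫
  n∈𝒫 = + suc N , trans (cong (λ i → + 2 * + i) (ℕ.+-identityʳ (p (suc N)))) (p-pentagonal (suc N))
  by-parity : (2 ∣ suc N × -1ℤ ^ suc N ≡ 1ℤ) ⊎ (¬ 2 ∣ suc N × -1ℤ ^ suc N ≡ -1ℤ) →
    ¬ (Odd (+ suc N) × Positive (+ suc N)) → - (-1ℤ ^ suc N) ≡ -1ℤ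
  by-parity (inj₁ (_ , eq))  _   = cong -_ eq
  by-parity (inj₂ (2∤m , _)) ¬op = contradiction (2∤m , +<+ (s≤s z≤n)) ¬op

formula-second : ∀ N → Formula (p N + (suc (N + N) + 0))
formula-second N = formula-𝒫 (p N + (suc (N + N) + 0)) n∈𝒫 (λ { (_ , ()) }) (λ _ → M-second N)
  where
  n∈𝒫 : p N + (suc (N + N) + 0) ∈ 𝒫
  n∈𝒫 = -[1+ N ] , trans (cong (λ i → + 2 * + (p N + i)) (ℕ.+-identityʳ (suc (N + N)))) (p-second-pentagonal N)

formula-first-gap : ∀ N t → suc t ≤ suc N + suc N → Formula (p (suc N) + suc t)
formula-first-gap N t t< =
  (λ (n∈𝒫 , _) → contradiction n∈𝒫 n∉𝒫) ,
  (λ (n∈𝒫 , _) → contradiction n∈𝒫 n∉𝒫) ,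
  (λ (_ , (odd , _) , same) → value (2∤n⇒-1^n≡-1 (subst Odd ⌊R⌋ odd)) (sign-t same)) ,
  (λ (_ , (even , _) , same) → value (2∣n⇒-1^n≡1 (subst Even ⌊R⌋ even)) (sign-t same)) ,
  (λ (_ , _ , neg) → contradiction (subst Negative ⌊R⌋ neg) λ { (+<+ ()) }) ,
  (λ (_ , _ , ¬case₃ , ¬case₄ , _) → otherwise (parity (suc N)) (parity (suc t)) ¬case₃ ¬case₄)
  where
  a = p (suc N)
  n = a + suc t
  ⌊n⌋ : ⌊ n ⌋ₚ ≡ a
  ⌊n⌋ = proj₁ (⌊⌋ₚ-first (suc N) t<)
  ⌊R⌋ : R⌊ n ⌋ₚ ≡ + suc N
  ⌊R⌋ = proj₂ (⌊⌋ₚ-first (suc N) t<)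
  n∉𝒫 : n ∉ 𝒫
  n∉𝒫 n∈𝒫 = ℕ.m≢1+m+n a (trans (sym ⌊n⌋) (trans (∈𝒫⇒⌊⌋ₚ≡ n∈𝒫) (ℕ.+-suc a t)))
  sign-t : n % 2 ≡ ⌊ n ⌋ₚ % 2 → -1ℤ ^ suc t ≡ 1ℤ
  sign-t same = [m+n]%2≡m%2⇒-1^n≡1 a (suc t) (trans same (cong (_% 2) ⌊n⌋))
  value : ∀ {s u} → -1ℤ ^ suc N ≡ s → -1ℤ ^ suc t ≡ u → M n ≡ - s * (u ⊕ 1ℤ)
  value s≡ u≡ = trans (M-first-gap N t t<) (cong₂ (λ s u → - s * (u ⊕ 1ℤ)) s≡ u≡)
  same-parity : 2 ∣ suc t → n % 2 ≡ ⌊ n ⌋ₚ % 2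
  same-parity 2∣t = trans (2∣n⇒[m+n]%2≡m%2 a 2∣t) (cong (_% 2) (sym ⌊n⌋))
  positive : Positive R⌊ n ⌋ₚ
  positive = subst Positive (sym ⌊R⌋) (+<+ (s≤s z≤n))
  otherwise : (2 ∣ suc N × -1ℤ ^ suc N ≡ 1ℤ) ⊎ (¬ 2 ∣ suc N × -1ℤ ^ suc N ≡ -1ℤ) →
    (2 ∣ suc t × -1ℤ ^ suc t ≡ 1ℤ) ⊎ (¬ 2 ∣ suc t × -1ℤ ^ suc t ≡ -1ℤ) →
    ¬ Case₃ n → ¬ Case₄ n → M n ≡ 0ℤ
  -- At an odd offset the factor u + 1 vanishes; an even offset falls under `Case₃` or `Case₄`.
  otherwise _ (inj₂ (_ , u≡)) _ _ = trans (value refl u≡) (ℤ.*-zeroʳ (- (-1ℤ ^ suc N)))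
  otherwise (inj₁ (2∣m , _)) (inj₁ (2∣t , _)) _ ¬case₄ =
    contradiction (n∉𝒫 , (subst Even (sym ⌊R⌋) 2∣m , positive) , same-parity 2∣t) ¬case₄
  otherwise (inj₂ (2∤m , _)) (inj₁ (2∣t , _)) ¬case₃ _ =
    contradiction (n∉𝒫 , (subst Odd (sym ⌊R⌋) 2∤m , positive) , same-parity 2∣t) ¬case₃

formula-second-gap : ∀ N t → suc t ≤ N → Formula (p N + (suc (N + N) + suc t))
formula-second-gap N t t< =
  (λ (n∈𝒫 , _) → contradiction n∈𝒫 n∉𝒫) ,
  (λ (n∈𝒫 , _) → contradiction n∈𝒫 n∉𝒫) ,
  (λ (_ , (_ , pos) , _) → contradiction (subst Positive ⌊R⌋ pos) λ ()) ,
  (λ (_ , (_ , pos) , _) → contradiction (subst Positive ⌊R⌋ pos) λ ()) ,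
  (λ (_ , even , _) → trans (value (2∣n⇒-1^n≡1 (subst Even ⌊R⌋ even)))
    (cong (λ i → - + 2 * -1ℤ ^ i) (sym n∸⌊n⌋))) ,
  -- Since R is negative here, failing `Case₅` means that R is odd, and the factor (-1)^(N+1) + 1 is
  -- zero.
  (λ (_ , _ , _ , _ , ¬case₅) → value (2∤n⇒-1^n≡-1 (λ even →
    ¬case₅ (n∉𝒫 , subst Even (sym ⌊R⌋) even , subst Negative (sym ⌊R⌋) -<+))))
  where
  a = p N + suc (N + N)
  n = p N + (suc (N + N) + suc t)
  n≡ : n ≡ a + suc t
  n≡ = sym (ℕ.+-assoc (p N) (suc (N + N)) (suc t))
  ⌊n⌋ : ⌊ n ⌋ₚ ≡ a
  ⌊n⌋ = proj₁ (⌊⌋ₚ-second N t<)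
  ⌊R⌋ : R⌊ n ⌋ₚ ≡ -[1+ N ]
  ⌊R⌋ = proj₂ (⌊⌋ₚ-second N t<)
  n∉𝒫 : n ∉ 𝒫
  n∉𝒫 n∈𝒫 = ℕ.m≢1+m+n a (trans (sym ⌊n⌋) (trans (∈𝒫⇒⌊⌋ₚ≡ n∈𝒫) (trans n≡ (ℕ.+-suc a t))))
  n∸⌊n⌋ : n ∸ ⌊ n ⌋ₚ ≡ suc t
  n∸⌊n⌋ = trans (cong₂ _∸_ n≡ ⌊n⌋) (ℕ.m+n∸m≡n a (suc t))
  value : ∀ {s} → -1ℤ ^ suc N ≡ s → M n ≡ - (s ⊕ 1ℤ) * -1ℤ ^ suc t
  value s≡ = trans (M-second-gap N t t<) (cong (λ s → - (s ⊕ 1ℤ) * -1ℤ ^ suc t) s≡)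

theorem1p7 : (n : ℕ) → 0 < n →
    (Case₁ n → + Mₑ n - + Mₒ n ≡ + 1) ×
    (Case₂ n → + Mₑ n - + Mₒ n ≡ - + 1) ×
    (Case₃ n → + Mₑ n - + Mₒ n ≡ + 2) ×
    (Case₄ n → + Mₑ n - + Mₒ n ≡ - + 2) ×
    (Case₅ n → + Mₑ n - + Mₒ n ≡ - + 2 * (- + 1) ^ (n ∸ ⌊ n ⌋ₚ)) ×
    (¬ Case₁ n × ¬ Case₂ n × ¬ Case₃ n × ¬ Case₄ n × ¬ Case₅ n → + Mₑ n - + Mₒ n ≡ + 0)
theorem1p7 n 0<n with position n
-- The first interval of block 0 is 0 alone.
theorem1p7 _ ()  | first zero zero _
... | first (suc N) zero    _  = formula-first N
... | first (suc N) (suc t) t< = formula-first-gap N t t<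
... | second N zero         _  = formula-second N
... | second N (suc t)      t< = formula-second-gap N t t<
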